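{- Let $n$ be a positive integer. Assume that (the image of) $B_{\mathfrak{B}_n}^{(1,2)}$ is a $\mathbb{C}$-vector space basis of $R_{\mathfrak{B}_n}^{(1,2)}$. Then the Hilbert series of $R_{\mathfrak{B}_n}^{(1,2)}$ is $$\sum_{\pi\in\Pi(n)_{\ge0}}u^{\deg_\theta(\pi)}\,v^{\deg_\xi(\pi)}\,\mathrm{stair}_q^B(\pi).$$
   Context: **The ring.** Let $\mathbb{C}[\boldsymbol{x}_n,\boldsymbol\theta_n,\boldsymbol\xi_n]$ be the algebra generated by commuting variables $x_1,\ldots,x_n$ (commuting with all variables) and variables $\theta_1,\ldots,\theta_n,\xi_1,\ldots,\xi_n$ which all anticommute with one another (so square to zero). The Weyl group $\mathfrak{B}_n$ of type $B_n$ (signed permutations) acts diagonally, by permuting the indices with sign, the same signed permutation acting on each of the three sets of variables. $R_{\mathfrak{B}_n}^{(1,2)}$ is the quotient by the ideal generated by all $\mathfrak{B}_n$-invariant elements with zero constant term. It is graded by $x$-, $\theta$- and $\xi$-degree; its Hilbert series is $\sum_{a,b,c}\dim\big((R_{\mathfrak{B}_n}^{(1,2)})_{a,b,c}\big)q^au^bv^c$, where the indexed component has $x$-degree $a$, $\theta$-degree $b$, $\xi$-degree $c$. **Paths and $B_{\mathfrak{B}_n}^{(1,2)}$.** $\Pi(n)_{\ge0}$ is the set of lattice paths $\pi=(p_1,\ldots,p_n)$ in $\mathbb{Z}^2$ starting at $(0,0)$ whose $i$-th step $p_i$ is one of: an (undecorated) up-step $(1,1)$; a horizontal step $(1,0)$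 with decoration $\theta_i$; a horizontal step $(1,0)$ with decoration $\xi_i$; a down-step $(1,-1)$ with decoration $\theta_i\xi_i$; such that the path never goes below the line $y=0$. Let $T(\pi)$ (resp. $S(\pi)$) be the set of indices $i\in\{1,\ldots,n\}$ such that $\theta_i$ (resp. $\xi_i$) occurs in the decoration of $p_i$; $\deg_\theta(\pi)=|T(\pi)|$, $\deg_\xi(\pi)=|S(\pi)|$. For $T,S\subseteq\{1,\ldots,n\}$ define $\beta(T,S)$ by $\beta_1(T,S)=-1+\chi(1\notin T)+\chi(1\notin S)$ and, for $2\le i\le n$, $\beta_i(T,S)=\beta_{i-1}(T,S)-2+\chi(i\notin T)+\chi(i-1\notin T)+\chi(i\notin S)+\chi(i-1\notin S)$, where $\chi(P)=1$ if $P$ is true and $0$ otherwise. $B_{\mathfrak{B}_n}^{(1,2)}$ is the set of monomials $x^\beta\theta_T\xi_S$ ($\theta_T,\xi_S$ the products in increasing order of indices; signs irrelevant) such that $(T,S)=(T(\pi),S(\pi))$ for some $\pi\in\Pi(n)_{\ge0}$ and $0\le\beta_i\le\beta_i(T,S)$ for all $i$. With $[m]_q=1+q+\cdots+q^{m-1}$, $\mathrm{stair}^B_q(\pi)=\prod_{i=1}^n[\beta_i(T(\pi),S(\pi))+1]_q$. -}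

module Defs where

open import Level using (Level; _⊔_; 0ℓ) renaming (suc to lsuc)
open import Algebra.Bundles using (Ring; CommutativeRing; CommutativeMonoid; Semiring; RawSemiring)
open import Algebra.Module.Bundles using (LeftModule)
import Algebra.Definitions.RawMonoid as RawMonoidDefs
import Algebra.Definitions.RawSemiring as RawSemiringDefs
import Algebra.Properties.Ring as RingProperties
import Algebra.Properties.AbelianGroup as AbelianGroupProperties
import Algebra.Properties.CommutativeSemigroup as CommutativeSemigroupProperties
import Relation.Binary.Reasoning.Setoid as SetoidReasoning
open import Data.Bool.Base using (if_then_else_; _∧_)
open import Data.Nat.Base as ℕ using (ℕ; zero; suc; _∸_; _≡ᵇ_)
import Data.Nat.Properties as ℕ
open import Data.Integer.Base as ℤ using (ℤ; +_; -[1+_]; 0ℤ; 1ℤ; -1ℤ)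
import Data.Integer.Properties as ℤ
open import Data.Rational.Base as Q using (ℚ; 0ℚ; 1ℚ; ½)
import Data.Rational.Properties as Q
import Data.Rational.Solver as QSolver
open import Data.Fin.Base using (Fin; toℕ)
open import Data.Fin.Permutation using (Permutation′; _⟨$⟩ʳ_)
open import Data.Fin.Subset using (Subset; Side; inside; outside; ∣_∣)
open import Data.Sign.Base as Sign using (Sign)
open import Data.List.Base as List using (List; cartesianProductWith; filter)
open import Data.Vec.Base as Vec using (Vec; []; _∷_; lookup)
open import Data.Vec.Relation.Unary.All as All using (All)
open import Data.Vec.Relation.Binary.Pointwise.Inductive using (Pointwise)
open import Data.Product.Base using (Σ; ∃; ∃₂; _×_; _,_; proj₁; proj₂)
open import Function.Base using (_∘_)
open import Function.Definitions using (Injective)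
open import Relation.Unary using (Pred; U)
open import Relation.Nullary using (Dec)
open import Relation.Binary.PropositionalEquality using (_≡_; refl; sym; trans; cong; subst)

private
  variable
    c ℓ m ℓm r ℓr p i : Level

------------------------------------------------------------------------
-- The complex numbers.  A real number is a Cauchy sequence of rationals,
-- and two of them are equal when their difference tends to 0.

module Reals where
  open import Data.Rational.Base using (_+_; _*_; _-_; -_; _<_; _≤_) renaming (∣_∣ to abs)
  open QSolver.+-*-Solver using (solve; _:=_; _:+_; _:*_; _:-_; :-_; con)

  Null : (ℕ → ℚ) → Set
  Null s = ∀ ε → 0ℚ < ε → ∃ λ N → ∀ k → N ℕ.≤ k → abs (s k) < ε

  Cauchy : (ℕ → ℚ) → Set
  Cauchy s = ∀ ε → 0ℚ < ε → ∃ λ N → ∀ j k → N ℕ.≤ j → N ℕ.≤ k → abs (s j - s k) < ε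

  ℝ : Set
  ℝ = Σ (ℕ → ℚ) Cauchy

  infix 4 _≈ʳ_
  _≈ʳ_ : ℝ → ℝ → Set
  (s , _) ≈ʳ (t , _) = Null (λ k → s k - t k)

  private
    EventuallyBounded : (ℕ → ℚ) → Set
    EventuallyBounded s = ∃₂ λ B N → 0ℚ < B × (∀ k → N ℕ.≤ k → abs (s k) < B)

    half : ∀ ε → ½ * ε + ½ * ε ≡ ε
    half ε = trans (sym (Q.*-distribʳ-+ ε ½ ½)) (trans (cong (_* ε) ½+½) (Q.*-identityˡ ε))
      where
      ½+½ : ½ + ½ ≡ 1ℚ
      ½+½ = refl

    half-pos : ∀ {ε} → 0ℚ < ε → 0ℚ < ½ * ε
    half-pos {ε} 0<ε = subst (_< ½ * ε) (Q.*-zeroʳ ½) (Q.*-monoʳ-<-pos ½ 0<ε)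

    add-< : ∀ {a b ε} → abs a < ½ * ε → abs b < ½ * ε → abs (a + b) < ε
    add-< {a} {b} {ε} p q =
      Q.≤-<-trans (Q.∣p+q∣≤∣p∣+∣q∣ a b) (subst (abs a + abs b <_) (half ε) (Q.+-mono-< p q))

    scaled : ∀ B ε → 0ℚ < B → 0ℚ < ε → ∃ λ δ → 0ℚ < δ × B * δ ≡ ε
    scaled B ε 0<B 0<ε = 1/B * ε , 0<δ , eq
      where
      instance
        B-pos : Q.Positive B
        B-pos = Q.positive 0<B
        B-nz : Q.NonZero B
        B-nz = Q.pos⇒nonZero B
      1/B : ℚ
      1/B = Q.1/ B
      instance
        1/B-pos : Q.Positive 1/B
        1/B-pos = Q.1/pos⇒pos B
      0<δ : 0ℚ < 1/B * ε
      0<δ = subst (_< 1/B * ε) (Q.*-zeroʳ 1/B) (Q.*-monoʳ-<-pos 1/B 0<ε)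
      eq : B * (1/B * ε) ≡ ε
      eq = trans (sym (Q.*-assoc B 1/B ε)) (trans (cong (_* ε) (Q.*-inverseʳ B)) (Q.*-identityˡ ε))

    mul-< : ∀ {a b B δ} → 0ℚ < B → abs a < B → abs b < δ → abs (a * b) < B * δ
    mul-< {a} {b} {B} {δ} 0<B p q =
      subst (_< B * δ) (sym (Q.∣p*q∣≡∣p∣*∣q∣ a b))
        (Q.≤-<-trans (Q.*-monoʳ-≤-nonNeg (abs b) {{Q.∣-∣-nonNeg b}} (Q.<⇒≤ p))
                     (Q.*-monoʳ-<-pos B {{Q.positive 0<B}} q))

    null-cong : ∀ {s t} → (∀ k → s k ≡ t k) → Null s → Null t
    null-cong e ns ε 0<ε with ns ε 0<ε
    ... | N , f = N , λ k N≤k → subst (λ z → abs z < ε) (e k) (f k N≤k)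

    null-0 : Null (λ _ → 0ℚ)
    null-0 ε 0<ε = 0 , λ _ _ → 0<ε

    null-+ : ∀ {s t} → Null s → Null t → Null (λ k → s k + t k)
    null-+ ns nt ε 0<ε with ns (½ * ε) (half-pos 0<ε) | nt (½ * ε) (half-pos 0<ε)
    ... | N , f | M , g = N ℕ.⊔ M , λ k h →
      add-< (f k (ℕ.≤-trans (ℕ.m≤m⊔n N M) h)) (g k (ℕ.≤-trans (ℕ.m≤n⊔m N M) h))

    null-neg : ∀ {s} → Null s → Null (λ k → - s k)
    null-neg {s} ns ε 0<ε with ns ε 0<ε
    ... | N , f = N , λ k h → subst (_< ε) (sym (Q.∣-p∣≡∣p∣ (s k))) (f k h)

    null-* : ∀ {s t} → EventuallyBounded s → Null t → Null (λ k → s k * t k)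
    null-* {s} {t} (B , N , 0<B , f) nt ε 0<ε with scaled B ε 0<B 0<ε
    ... | δ , 0<δ , eq with nt δ 0<δ
    ...   | M , g = N ℕ.⊔ M , λ k h →
      subst (abs (s k * t k) <_) eq
        (mul-< 0<B (f k (ℕ.≤-trans (ℕ.m≤m⊔n N M) h)) (g k (ℕ.≤-trans (ℕ.m≤n⊔m N M) h)))

    0<1 : 0ℚ < 1ℚ
    0<1 = Q.positive⁻¹ 1ℚ

    bounded : ∀ {s} → Cauchy s → EventuallyBounded s
    bounded {s} cs with cs 1ℚ 0<1
    ... | N , f = 1ℚ + abs (s N) , N , pos , λ k h → bd k (f k N h ℕ.≤-refl)
      where
      pos : 0ℚ < 1ℚ + abs (s N)
      pos = Q.+-mono-<-≤ 0<1 (Q.0≤∣p∣ (s N))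
      e : ∀ a b → (a - b) + b ≡ a
      e = solve 2 (λ a b → (a :- b) :+ b := a) refl
      bd : ∀ k → abs (s k - s N) < 1ℚ → abs (s k) < 1ℚ + abs (s N)
      bd k h = Q.≤-<-trans
        (subst (λ z → abs z ≤ abs (s k - s N) + abs (s N)) (e (s k) (s N)) (Q.∣p+q∣≤∣p∣+∣q∣ (s k - s N) (s N)))
        (Q.+-monoˡ-< (abs (s N)) h)

    cauchy-const : ∀ q → Cauchy (λ _ → q)
    cauchy-const q ε 0<ε = 0 , λ _ _ _ _ → subst (λ z → abs z < ε) (sym (Q.+-inverseʳ q)) 0<ε

    cauchy-+ : ∀ {s t} → Cauchy s → Cauchy t → Cauchy (λ k → s k + t k)
    cauchy-+ {s} {t} cs ct ε 0<ε with cs (½ * ε) (half-pos 0<ε) | ct (½ * ε) (half-pos 0<ε)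
    ... | N , f | M , g = N ℕ.⊔ M , λ j k hj hk →
      subst (λ z → abs z < ε) (e (s j) (s k) (t j) (t k))
        (add-< (f j k (ℕ.≤-trans (ℕ.m≤m⊔n N M) hj) (ℕ.≤-trans (ℕ.m≤m⊔n N M) hk))
               (g j k (ℕ.≤-trans (ℕ.m≤n⊔m N M) hj) (ℕ.≤-trans (ℕ.m≤n⊔m N M) hk)))
      where
      e : ∀ a b a′ b′ → (a - b) + (a′ - b′) ≡ (a + a′) - (b + b′)
      e = solve 4 (λ a b a′ b′ → (a :- b) :+ (a′ :- b′) := (a :+ a′) :- (b :+ b′)) refl

    cauchy-neg : ∀ {s} → Cauchy s → Cauchy (λ k → - s k)
    cauchy-neg {s} cs ε 0<ε with cs ε 0<ε
    ... | N , f = N , λ j k hj hk → subst (λ z → abs z < ε) (e (s k) (s j)) (f k j hk hj)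
      where
      e : ∀ a b → a - b ≡ (- b) - (- a)
      e = solve 2 (λ a b → a :- b := (:- b) :- (:- a)) refl

    cauchy-* : ∀ {s t} → Cauchy s → Cauchy t → Cauchy (λ k → s k * t k)
    cauchy-* {s} {t} cs ct ε 0<ε = go (bounded {s} cs) (bounded {t} ct)
      where
      Goal : Set
      Goal = ∃ λ N → ∀ j k → N ℕ.≤ j → N ℕ.≤ k → abs (s j * t j - s k * t k) < ε
      e : ∀ a b a′ b′ → a * (a′ - b′) + b′ * (a - b) ≡ a * a′ - b * b′
      e = solve 4 (λ a b a′ b′ → a :* (a′ :- b′) :+ b′ :* (a :- b) := a :* a′ :- b :* b′) refl
      part : ∀ {B δ} a b → B * δ ≡ ½ * ε → 0ℚ < B → abs a < B → abs b < δ → abs (a * b) < ½ * ε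
      part a b eq 0<B p q = subst (abs (a * b) <_) eq (mul-< {a} {b} 0<B p q)
      go : EventuallyBounded s → EventuallyBounded t → Goal
      go (B , N₁ , 0<B , f₁) (C , N₂ , 0<C , f₂) =
        go₂ (scaled B (½ * ε) 0<B (half-pos 0<ε)) (scaled C (½ * ε) 0<C (half-pos 0<ε))
        where
        go₂ : (∃ λ δ → 0ℚ < δ × B * δ ≡ ½ * ε) → (∃ λ η → 0ℚ < η × C * η ≡ ½ * ε) → Goal
        go₂ (δ , 0<δ , eqB) (η , 0<η , eqC) = go₃ (ct δ 0<δ) (cs η 0<η)
          where
          go₃ : (∃ λ N → ∀ j k → N ℕ.≤ j → N ℕ.≤ k → abs (t j - t k) < δ)
              → (∃ λ N → ∀ j k → N ℕ.≤ j → N ℕ.≤ k → abs (s j - s k) < η) → Goal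
          go₃ (N₃ , g₁) (N₄ , g₂) = N , λ j k hj hk →
            subst (λ z → abs z < ε) (e (s j) (s k) (t j) (t k))
              (add-< {s j * (t j - t k)} {t k * (s j - s k)} {ε}
                (part (s j) (t j - t k) eqB 0<B (f₁ j (h₁ hj)) (g₁ j k (h₃ hj) (h₃ hk)))
                (part (t k) (s j - s k) eqC 0<C (f₂ k (h₂ hk)) (g₂ j k (h₄ hj) (h₄ hk))))
            where
            N : ℕ
            N = (N₁ ℕ.⊔ N₂) ℕ.⊔ (N₃ ℕ.⊔ N₄)
            h₁ : ∀ {k} → N ℕ.≤ k → N₁ ℕ.≤ k
            h₁ = ℕ.m⊔n≤o⇒m≤o N₁ N₂ ∘ ℕ.m⊔n≤o⇒m≤o (N₁ ℕ.⊔ N₂) (N₃ ℕ.⊔ N₄)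
            h₂ : ∀ {k} → N ℕ.≤ k → N₂ ℕ.≤ k
            h₂ = ℕ.m⊔n≤o⇒n≤o N₁ N₂ ∘ ℕ.m⊔n≤o⇒m≤o (N₁ ℕ.⊔ N₂) (N₃ ℕ.⊔ N₄)
            h₃ : ∀ {k} → N ℕ.≤ k → N₃ ℕ.≤ k
            h₃ = ℕ.m⊔n≤o⇒m≤o N₃ N₄ ∘ ℕ.m⊔n≤o⇒n≤o (N₁ ℕ.⊔ N₂) (N₃ ℕ.⊔ N₄)
            h₄ : ∀ {k} → N ℕ.≤ k → N₄ ℕ.≤ k
            h₄ = ℕ.m⊔n≤o⇒n≤o N₃ N₄ ∘ ℕ.m⊔n≤o⇒n≤o (N₁ ℕ.⊔ N₂) (N₃ ℕ.⊔ N₄)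

  _+ʳ_ _*ʳ_ : ℝ → ℝ → ℝ
  (s , cs) +ʳ (t , ct) = (λ k → s k + t k) , cauchy-+ {s} {t} cs ct
  (s , cs) *ʳ (t , ct) = (λ k → s k * t k) , cauchy-* {s} {t} cs ct

  -ʳ_ : ℝ → ℝ
  -ʳ (s , cs) = (λ k → - s k) , cauchy-neg {s} cs

  fromℚ : ℚ → ℝ
  fromℚ q = (λ _ → q) , cauchy-const q

  private
    pointwise : ∀ {x y : ℝ} → (∀ k → proj₁ x k ≡ proj₁ y k) → x ≈ʳ y
    pointwise {x} {y} e =
      null-cong (λ k → sym (trans (cong (_- proj₁ y k) (e k)) (Q.+-inverseʳ (proj₁ y k)))) null-0

    ≈ʳ-refl : ∀ {x} → x ≈ʳ x
    ≈ʳ-refl {x} = pointwise {x} {x} λ _ → refl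

    ≈ʳ-sym : ∀ {x y} → x ≈ʳ y → y ≈ʳ x
    ≈ʳ-sym {x} {y} h = null-cong (λ k → e (proj₁ x k) (proj₁ y k)) (null-neg {λ k → proj₁ x k - proj₁ y k} h)
      where
      e : ∀ a b → - (a - b) ≡ b - a
      e = solve 2 (λ a b → :- (a :- b) := b :- a) refl

    ≈ʳ-trans : ∀ {x y z} → x ≈ʳ y → y ≈ʳ z → x ≈ʳ z
    ≈ʳ-trans {x} {y} {z} h h′ = null-cong (λ k → e (proj₁ x k) (proj₁ y k) (proj₁ z k))
      (null-+ {λ k → proj₁ x k - proj₁ y k} {λ k → proj₁ y k - proj₁ z k} h h′)
      where
      e : ∀ a b d → (a - b) + (b - d) ≡ a - d
      e = solve 3 (λ a b d → (a :- b) :+ (b :- d) := a :- d) refl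

    +ʳ-cong : ∀ {x y u v} → x ≈ʳ y → u ≈ʳ v → (x +ʳ u) ≈ʳ (y +ʳ v)
    +ʳ-cong {x} {y} {u} {v} h h′ =
      null-cong (λ k → e (proj₁ x k) (proj₁ y k) (proj₁ u k) (proj₁ v k))
        (null-+ {λ k → proj₁ x k - proj₁ y k} {λ k → proj₁ u k - proj₁ v k} h h′)
      where
      e : ∀ a b a′ b′ → (a - b) + (a′ - b′) ≡ (a + a′) - (b + b′)
      e = solve 4 (λ a b a′ b′ → (a :- b) :+ (a′ :- b′) := (a :+ a′) :- (b :+ b′)) refl

    -ʳ-cong : ∀ {x y} → x ≈ʳ y → (-ʳ x) ≈ʳ (-ʳ y)
    -ʳ-cong {x} {y} h = null-cong (λ k → e (proj₁ x k) (proj₁ y k)) (null-neg {λ k → proj₁ x k - proj₁ y k} h)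
      where
      e : ∀ a b → - (a - b) ≡ (- a) - (- b)
      e = solve 2 (λ a b → :- (a :- b) := (:- a) :- (:- b)) refl

    *ʳ-cong : ∀ {x y u v} → x ≈ʳ y → u ≈ʳ v → (x *ʳ u) ≈ʳ (y *ʳ v)
    *ʳ-cong {x} {y} {u} {v} h h′ =
      null-cong (λ k → e (proj₁ x k) (proj₁ y k) (proj₁ u k) (proj₁ v k))
        (null-+ {λ k → proj₁ x k * (proj₁ u k - proj₁ v k)} {λ k → proj₁ v k * (proj₁ x k - proj₁ y k)}
          (null-* {proj₁ x} {λ k → proj₁ u k - proj₁ v k} (bounded {proj₁ x} (proj₂ x)) h′)
          (null-* {proj₁ v} {λ k → proj₁ x k - proj₁ y k} (bounded {proj₁ v} (proj₂ v)) h))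
      where
      e : ∀ a b a′ b′ → a * (a′ - b′) + b′ * (a - b) ≡ a * a′ - b * b′
      e = solve 4 (λ a b a′ b′ → a :* (a′ :- b′) :+ b′ :* (a :- b) := a :* a′ :- b :* b′) refl

  ℝ-commutativeRing : CommutativeRing 0ℓ 0ℓ
  ℝ-commutativeRing = record
    { Carrier = ℝ ; _≈_ = _≈ʳ_ ; _+_ = _+ʳ_ ; _*_ = _*ʳ_ ; -_ = -ʳ_ ; 0# = fromℚ 0ℚ ; 1# = fromℚ 1ℚ
    ; isCommutativeRing = record
      { isRing = record
        { +-isAbelianGroup = record
          { isGroup = record
            { isMonoid = record
              { isSemigroup = record
                { isMagma = record
                  { isEquivalence = record
                    { refl = λ {x} → ≈ʳ-refl {x}
                    ; sym = λ {x} {y} → ≈ʳ-sym {x} {y}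
                    ; trans = λ {x} {y} {z} → ≈ʳ-trans {x} {y} {z} }
                  ; ∙-cong = λ {x} {y} {u} {v} → +ʳ-cong {x} {y} {u} {v} }
                ; assoc = λ x y z → pointwise {(x +ʳ y) +ʳ z} {x +ʳ (y +ʳ z)}
                    λ k → Q.+-assoc (proj₁ x k) (proj₁ y k) (proj₁ z k) }
              ; identity =
                  (λ x → pointwise {fromℚ 0ℚ +ʳ x} {x} λ k → Q.+-identityˡ (proj₁ x k))
                , (λ x → pointwise {x +ʳ fromℚ 0ℚ} {x} λ k → Q.+-identityʳ (proj₁ x k)) }
            ; inverse =
                (λ x → pointwise {(-ʳ x) +ʳ x} {fromℚ 0ℚ} λ k → Q.+-inverseˡ (proj₁ x k))
              , (λ x → pointwise {x +ʳ (-ʳ x)} {fromℚ 0ℚ} λ k → Q.+-inverseʳ (proj₁ x k))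
            ; ⁻¹-cong = λ {x} {y} → -ʳ-cong {x} {y} }
          ; comm = λ x y → pointwise {x +ʳ y} {y +ʳ x} λ k → Q.+-comm (proj₁ x k) (proj₁ y k) }
        ; *-cong = λ {x} {y} {u} {v} → *ʳ-cong {x} {y} {u} {v}
        ; *-assoc = λ x y z → pointwise {(x *ʳ y) *ʳ z} {x *ʳ (y *ʳ z)}
            λ k → Q.*-assoc (proj₁ x k) (proj₁ y k) (proj₁ z k)
        ; *-identity =
            (λ x → pointwise {fromℚ 1ℚ *ʳ x} {x} λ k → Q.*-identityˡ (proj₁ x k))
          , (λ x → pointwise {x *ʳ fromℚ 1ℚ} {x} λ k → Q.*-identityʳ (proj₁ x k))
        ; distrib =
            (λ x y z → pointwise {x *ʳ (y +ʳ z)} {(x *ʳ y) +ʳ (x *ʳ z)}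
              λ k → Q.*-distribˡ-+ (proj₁ x k) (proj₁ y k) (proj₁ z k))
          , (λ x y z → pointwise {(y +ʳ z) *ʳ x} {(y *ʳ x) +ʳ (z *ʳ x)}
              λ k → Q.*-distribʳ-+ (proj₁ x k) (proj₁ y k) (proj₁ z k)) }
      ; *-comm = λ x y → pointwise {x *ʳ y} {y *ʳ x} λ k → Q.*-comm (proj₁ x k) (proj₁ y k) } }

-- R[i] with i² = -1; the pair (a , b) stands for a + bi.
module AdjoinI {c ℓ} (R : CommutativeRing c ℓ) where
  open CommutativeRing R using (Carrier; _≈_; _+_; _*_; -_; _-_; 0#; 1#)

  infix 4 _≈ⁱ_
  _≈ⁱ_ : Carrier × Carrier → Carrier × Carrier → Set ℓ
  (a , b) ≈ⁱ (a′ , b′) = a ≈ a′ × b ≈ b′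

  _+ⁱ_ _*ⁱ_ : Carrier × Carrier → Carrier × Carrier → Carrier × Carrier
  (a , b) +ⁱ (a′ , b′) = a + a′ , b + b′
  (a , b) *ⁱ (a′ , b′) = a * a′ - b * b′ , a * b′ + b * a′

  -ⁱ_ : Carrier × Carrier → Carrier × Carrier
  -ⁱ (a , b) = - a , - b

  private
    module R = CommutativeRing R
    module RP = RingProperties R.ring
    open CommutativeSemigroupProperties R.+-commutativeSemigroup using (interchange)
    open SetoidReasoning R.setoid

    -sum : ∀ x y → - (x + y) ≈ - x + - y
    -sum x y = R.sym (RP.-‿+-comm x y)

    dist₁ : ∀ a b a′ b′ a″ b″ →
      a * (a′ + a″) - b * (b′ + b″) ≈ (a * a′ - b * b′) + (a * a″ - b * b″)
    dist₁ a b a′ b′ a″ b″ = begin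
      a * (a′ + a″) - b * (b′ + b″)
        ≈⟨ R.+-cong (R.distribˡ a a′ a″) (R.trans (R.-‿cong (R.distribˡ b b′ b″)) (-sum _ _)) ⟩
      (a * a′ + a * a″) + (- (b * b′) + - (b * b″))
        ≈⟨ interchange _ _ _ _ ⟩
      (a * a′ - b * b′) + (a * a″ - b * b″) ∎

    dist₂ : ∀ a b a′ b′ a″ b″ →
      a * (b′ + b″) + b * (a′ + a″) ≈ (a * b′ + b * a′) + (a * b″ + b * a″)
    dist₂ a b a′ b′ a″ b″ =
      R.trans (R.+-cong (R.distribˡ a b′ b″) (R.distribˡ b a′ a″)) (interchange _ _ _ _)

    assoc₁ : ∀ a b a′ b′ a″ b″ →
      (a * a′ - b * b′) * a″ - (a * b′ + b * a′) * b″ ≈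
      a * (a′ * a″ - b′ * b″) - b * (a′ * b″ + b′ * a″)
    assoc₁ a b a′ b′ a″ b″ = begin
      (a * a′ - b * b′) * a″ - (a * b′ + b * a′) * b″
        ≈⟨ R.+-cong (R.distribʳ a″ _ _) (R.trans (R.-‿cong (R.distribʳ b″ _ _)) (-sum _ _)) ⟩
      (a * a′ * a″ + - (b * b′) * a″) + (- (a * b′ * b″) + - (b * a′ * b″))
        ≈⟨ interchange _ _ _ _ ⟩
      (a * a′ * a″ + - (a * b′ * b″)) + (- (b * b′) * a″ + - (b * a′ * b″))
        ≈⟨ R.+-cong
             (R.+-cong (R.*-assoc a a′ a″)
               (R.trans (R.-‿cong (R.*-assoc a b′ b″)) (RP.-‿distribʳ-* a (b′ * b″))))
             (R.trans (R.+-comm _ _) (R.+-cong (R.-‿cong (R.*-assoc b a′ b″))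
               (R.trans (R.sym (RP.-‿distribˡ-* _ _)) (R.-‿cong (R.*-assoc b b′ a″))))) ⟩
      (a * (a′ * a″) + a * - (b′ * b″)) + (- (b * (a′ * b″)) + - (b * (b′ * a″)))
        ≈⟨ R.+-cong (R.sym (R.distribˡ a _ _))
             (R.trans (R.sym (-sum _ _)) (R.-‿cong (R.sym (R.distribˡ b _ _)))) ⟩
      a * (a′ * a″ - b′ * b″) - b * (a′ * b″ + b′ * a″) ∎

    assoc₂ : ∀ a b a′ b′ a″ b″ →
      (a * a′ - b * b′) * b″ + (a * b′ + b * a′) * a″ ≈
      a * (a′ * b″ + b′ * a″) + b * (a′ * a″ - b′ * b″)
    assoc₂ a b a′ b′ a″ b″ = begin
      (a * a′ - b * b′) * b″ + (a * b′ + b * a′) * a″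
        ≈⟨ R.+-cong (R.distribʳ b″ _ _) (R.distribʳ a″ _ _) ⟩
      (a * a′ * b″ + - (b * b′) * b″) + (a * b′ * a″ + b * a′ * a″)
        ≈⟨ interchange _ _ _ _ ⟩
      (a * a′ * b″ + a * b′ * a″) + (- (b * b′) * b″ + b * a′ * a″)
        ≈⟨ R.+-cong
             (R.+-cong (R.*-assoc a a′ b″) (R.*-assoc a b′ a″))
             (R.trans (R.+-comm _ _) (R.+-cong (R.*-assoc b a′ a″)
               (R.trans (R.sym (RP.-‿distribˡ-* _ _))
                 (R.trans (R.-‿cong (R.*-assoc b b′ b″)) (RP.-‿distribʳ-* b (b′ * b″)))))) ⟩
      (a * (a′ * b″) + a * (b′ * a″)) + (b * (a′ * a″) + b * - (b′ * b″))
        ≈⟨ R.+-cong (R.sym (R.distribˡ a _ _)) (R.sym (R.distribˡ b _ _)) ⟩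
      a * (a′ * b″ + b′ * a″) + b * (a′ * a″ - b′ * b″) ∎

    ≈ⁱ-trans : ∀ {x y z} → x ≈ⁱ y → y ≈ⁱ z → x ≈ⁱ z
    ≈ⁱ-trans (p , q) (p′ , q′) = R.trans p p′ , R.trans q q′

    *ⁱ-comm : ∀ x y → (x *ⁱ y) ≈ⁱ (y *ⁱ x)
    *ⁱ-comm (a , b) (a′ , b′) =
        R.+-cong (R.*-comm a a′) (R.-‿cong (R.*-comm b b′))
      , R.trans (R.+-comm _ _) (R.+-cong (R.*-comm b a′) (R.*-comm a b′))

    *ⁱ-idˡ : ∀ x → ((1# , 0#) *ⁱ x) ≈ⁱ x
    *ⁱ-idˡ (a , b) =
        R.trans (R.+-cong (R.*-identityˡ a) (R.trans (R.-‿cong (R.zeroˡ b)) RP.-0#≈0#)) (R.+-identityʳ a)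
      , R.trans (R.+-cong (R.*-identityˡ b) (R.zeroˡ a)) (R.+-identityʳ b)

    *ⁱ-distˡ : ∀ x y z → (x *ⁱ (y +ⁱ z)) ≈ⁱ ((x *ⁱ y) +ⁱ (x *ⁱ z))
    *ⁱ-distˡ (a , b) (a′ , b′) (a″ , b″) = dist₁ a b a′ b′ a″ b″ , dist₂ a b a′ b′ a″ b″

    +ⁱ-cong : ∀ {x y u v} → x ≈ⁱ y → u ≈ⁱ v → (x +ⁱ u) ≈ⁱ (y +ⁱ v)
    +ⁱ-cong (p , q) (p′ , q′) = R.+-cong p p′ , R.+-cong q q′

  commutativeRing : CommutativeRing c ℓ
  commutativeRing = record
    { Carrier = Carrier × Carrier ; _≈_ = _≈ⁱ_
    ; _+_ = _+ⁱ_ ; _*_ = _*ⁱ_ ; -_ = -ⁱ_ ; 0# = 0# , 0# ; 1# = 1# , 0#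
    ; isCommutativeRing = record
      { isRing = record
        { +-isAbelianGroup = record
          { isGroup = record
            { isMonoid = record
              { isSemigroup = record
                { isMagma = record
                  { isEquivalence = record
                    { refl = R.refl , R.refl
                    ; sym = λ (p , q) → R.sym p , R.sym q
                    ; trans = ≈ⁱ-trans }
                  ; ∙-cong = +ⁱ-cong }
                ; assoc = λ (a , b) (a′ , b′) (a″ , b″) → R.+-assoc a a′ a″ , R.+-assoc b b′ b″ }
              ; identity = (λ (a , b) → R.+-identityˡ a , R.+-identityˡ b)
                         , (λ (a , b) → R.+-identityʳ a , R.+-identityʳ b) }
            ; inverse = (λ (a , b) → R.-‿inverseˡ a , R.-‿inverseˡ b)
                      , (λ (a , b) → R.-‿inverseʳ a , R.-‿inverseʳ b)
            ; ⁻¹-cong = λ (p , q) → R.-‿cong p , R.-‿cong q }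
          ; comm = λ (a , b) (a′ , b′) → R.+-comm a a′ , R.+-comm b b′ }
        ; *-cong = λ (p , q) (p′ , q′) →
            R.+-cong (R.*-cong p p′) (R.-‿cong (R.*-cong q q′)) , R.+-cong (R.*-cong p q′) (R.*-cong q p′)
        ; *-assoc = λ (a , b) (a′ , b′) (a″ , b″) → assoc₁ a b a′ b′ a″ b″ , assoc₂ a b a′ b′ a″ b″
        ; *-identity = *ⁱ-idˡ , λ x → ≈ⁱ-trans (*ⁱ-comm x (1# , 0#)) (*ⁱ-idˡ x)
        ; distrib = *ⁱ-distˡ
            , λ x y z → ≈ⁱ-trans (*ⁱ-comm (y +ⁱ z) x)
                (≈ⁱ-trans (*ⁱ-distˡ x y z) (+ⁱ-cong (*ⁱ-comm x y) (*ⁱ-comm x z))) }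
      ; *-comm = *ⁱ-comm } }

ℂ : CommutativeRing 0ℓ 0ℓ
ℂ = AdjoinI.commutativeRing Reals.ℝ-commutativeRing

------------------------------------------------------------------------
-- Modules: submodules, quotients, bases, dimension.

module _ {K : Ring r ℓr} (M : LeftModule K m ℓm) where
  open Ring K using (Carrier; 1#; -_) renaming (_≈_ to _≈ᴷ_; 0# to 0ᴷ)
  open LeftModule M

  private
    module K = Ring K
    module G = AbelianGroupProperties +ᴹ-abelianGroup
    open CommutativeSemigroupProperties
      (CommutativeMonoid.commutativeSemigroup +ᴹ-commutativeMonoid) using (interchange)

    infixl 6 _-ᴹ_
    _-ᴹ_ : Carrierᴹ → Carrierᴹ → Carrierᴹ
    x -ᴹ y = x +ᴹ -ᴹ y

  linearCombination : ∀ {k} → (Fin k → Carrier) → (Fin k → Carrierᴹ) → Carrierᴹ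
  linearCombination a v = RawMonoidDefs.sum +ᴹ-rawMonoid (λ j → a j *ₗ v j)

  -- The family (v t), for the indices t satisfying P, is a basis of M.
  -- Independence is asked of the family: v t and v t′ with t ≢ t′ count
  -- as two vectors even when they are equal in M.
  record IsBasis {I : Set i} (P : Pred I p) (v : I → Carrierᴹ) : Set (r ⊔ ℓr ⊔ m ⊔ ℓm ⊔ i ⊔ p) where
    field
      spans : ∀ x → ∃ λ k → ∃₂ λ (t : Fin k → I) (a : Fin k → Carrier) →
        (∀ j → P (t j)) × x ≈ᴹ linearCombination a (v ∘ t)
      independent : ∀ {k} (t : Fin k → I) → Injective _≡_ _≡_ t → (∀ j → P (t j)) →
        ∀ (a : Fin k → Carrier) → linearCombination a (v ∘ t) ≈ᴹ 0ᴹ → ∀ j → a j ≈ᴷ 0ᴷ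

  HasDimension : ℕ → Set (r ⊔ ℓr ⊔ m ⊔ ℓm)
  HasDimension d = ∃ λ (v : Fin d → Carrierᴹ) → IsBasis U v

  record IsSubmodule (P : Pred Carrierᴹ p) : Set (r ⊔ m ⊔ ℓm ⊔ p) where
    field
      resp : ∀ {x y} → x ≈ᴹ y → P x → P y
      0∈   : P 0ᴹ
      +∈   : ∀ {x y} → P x → P y → P (x +ᴹ y)
      *ₗ∈  : ∀ k {x} → P x → P (k *ₗ x)

  private
    -1*ₗ : ∀ x → (- 1#) *ₗ x ≈ᴹ -ᴹ x
    -1*ₗ x = G.inverseˡ-unique ((- 1#) *ₗ x) x
      (≈ᴹ-trans (+ᴹ-congˡ (≈ᴹ-sym (*ₗ-identityˡ x)))
        (≈ᴹ-trans (≈ᴹ-sym (*ₗ-distribʳ x (- 1#) 1#))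
          (≈ᴹ-trans (*ₗ-cong (K.-‿inverseˡ 1#) ≈ᴹ-refl) (*ₗ-zeroˡ x))))

    *ₗ-neg : ∀ k x → k *ₗ (-ᴹ x) ≈ᴹ -ᴹ (k *ₗ x)
    *ₗ-neg k x = G.inverseˡ-unique (k *ₗ (-ᴹ x)) (k *ₗ x)
      (≈ᴹ-trans (≈ᴹ-sym (*ₗ-distribˡ k (-ᴹ x) x))
        (≈ᴹ-trans (*ₗ-cong K.refl (-ᴹ‿inverseˡ x)) (*ₗ-zeroʳ k)))

  module _ {P : Pred Carrierᴹ p} (isSubmodule : IsSubmodule P) where
    open IsSubmodule isSubmodule

    private
      -∈ : ∀ {x} → P x → P (-ᴹ x)
      -∈ {x} Px = resp (-1*ₗ x) (*ₗ∈ (- 1#) Px)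

      infix 4 _∼_
      _∼_ : Carrierᴹ → Carrierᴹ → Set _
      x ∼ y = P (x -ᴹ y)

      ≈⇒∼ : ∀ {x y} → x ≈ᴹ y → x ∼ y
      ≈⇒∼ {x} {y} x≈y = resp (≈ᴹ-sym (≈ᴹ-trans (+ᴹ-congʳ x≈y) (-ᴹ‿inverseʳ y))) 0∈

      ∼-sym : ∀ {x y} → x ∼ y → y ∼ x
      ∼-sym {x} {y} h = resp (G.⁻¹-anti-homo‿- x y) (-∈ h)

      ∼-trans : ∀ {x y z} → x ∼ y → y ∼ z → x ∼ z
      ∼-trans {x} {y} {z} h h′ = resp
        (≈ᴹ-trans (≈ᴹ-sym (+ᴹ-assoc (x -ᴹ y) y (-ᴹ z))) (+ᴹ-congʳ (G.//-rightDividesˡ y x)))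
        (+∈ h h′)

      +-cong : ∀ {x y u v} → x ∼ y → u ∼ v → (x +ᴹ u) ∼ (y +ᴹ v)
      +-cong {x} {y} {u} {v} h h′ = resp
        (≈ᴹ-trans (interchange x (-ᴹ y) u (-ᴹ v)) (+ᴹ-congˡ (G.⁻¹-∙-comm y v)))
        (+∈ h h′)

      neg-cong : ∀ {x y} → x ∼ y → (-ᴹ x) ∼ (-ᴹ y)
      neg-cong {x} {y} h = resp (≈ᴹ-sym (G.⁻¹-∙-comm x (-ᴹ y))) (-∈ h)

      scale-cong : ∀ {k k′ x y} → k ≈ᴷ k′ → x ∼ y → (k *ₗ x) ∼ (k′ *ₗ y)
      scale-cong {k} {k′} {x} {y} e h = resp
        (≈ᴹ-trans (*ₗ-distribˡ k x (-ᴹ y))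
          (+ᴹ-congˡ (≈ᴹ-trans (*ₗ-neg k y) (-ᴹ‿cong (*ₗ-cong e ≈ᴹ-refl)))))
        (*ₗ∈ k h)

    quotient : LeftModule K m p
    quotient = record
      { Carrierᴹ = Carrierᴹ ; _≈ᴹ_ = λ x y → P (x +ᴹ -ᴹ y)
      ; _+ᴹ_ = _+ᴹ_ ; _*ₗ_ = _*ₗ_ ; 0ᴹ = 0ᴹ ; -ᴹ_ = -ᴹ_
      ; isLeftModule = record
        { isLeftSemimodule = record
          { +ᴹ-isCommutativeMonoid = record
            { isMonoid = record
              { isSemigroup = record
                { isMagma = record
                  { isEquivalence = record { refl = ≈⇒∼ ≈ᴹ-refl ; sym = ∼-sym ; trans = ∼-trans }
                  ; ∙-cong = +-cong }
                ; assoc = λ x y z → ≈⇒∼ (+ᴹ-assoc x y z) }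
              ; identity = (λ x → ≈⇒∼ (+ᴹ-identityˡ x)) , (λ x → ≈⇒∼ (+ᴹ-identityʳ x)) }
            ; comm = λ x y → ≈⇒∼ (+ᴹ-comm x y) }
          ; isPreleftSemimodule = record
            { *ₗ-cong = scale-cong
            ; *ₗ-zeroˡ = λ x → ≈⇒∼ (*ₗ-zeroˡ x)
            ; *ₗ-distribʳ = λ x k l → ≈⇒∼ (*ₗ-distribʳ x k l)
            ; *ₗ-identityˡ = λ x → ≈⇒∼ (*ₗ-identityˡ x)
            ; *ₗ-assoc = λ k l x → ≈⇒∼ (*ₗ-assoc k l x)
            ; *ₗ-zeroʳ = λ k → ≈⇒∼ (*ₗ-zeroʳ k)
            ; *ₗ-distribˡ = λ k x y → ≈⇒∼ (*ₗ-distribˡ k x y) } }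
        ; -ᴹ‿cong = neg-cong
        ; -ᴹ‿inverse = (λ x → ≈⇒∼ (-ᴹ‿inverseˡ x)) , (λ x → ≈⇒∼ (-ᴹ‿inverseʳ x)) } }

    submodule : LeftModule K (m ⊔ p) ℓm
    submodule = record
      { Carrierᴹ = Σ Carrierᴹ P ; _≈ᴹ_ = λ x y → proj₁ x ≈ᴹ proj₁ y
      ; _+ᴹ_ = λ (x , Px) (y , Py) → x +ᴹ y , +∈ Px Py
      ; _*ₗ_ = λ k (x , Px) → k *ₗ x , *ₗ∈ k Px
      ; 0ᴹ = 0ᴹ , 0∈ ; -ᴹ_ = λ (x , Px) → -ᴹ x , -∈ Px
      ; isLeftModule = record
        { isLeftSemimodule = record
          { +ᴹ-isCommutativeMonoid = record
            { isMonoid = record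
              { isSemigroup = record
                { isMagma = record
                  { isEquivalence = record { refl = ≈ᴹ-refl ; sym = ≈ᴹ-sym ; trans = ≈ᴹ-trans }
                  ; ∙-cong = +ᴹ-cong }
                ; assoc = λ (x , _) (y , _) (z , _) → +ᴹ-assoc x y z }
              ; identity = (λ (x , _) → +ᴹ-identityˡ x) , (λ (x , _) → +ᴹ-identityʳ x) }
            ; comm = λ (x , _) (y , _) → +ᴹ-comm x y }
          ; isPreleftSemimodule = record
            { *ₗ-cong = *ₗ-cong
            ; *ₗ-zeroˡ = λ (x , _) → *ₗ-zeroˡ x
            ; *ₗ-distribʳ = λ (x , _) k l → *ₗ-distribʳ x k l
            ; *ₗ-identityˡ = λ (x , _) → *ₗ-identityˡ x
            ; *ₗ-assoc = λ k l (x , _) → *ₗ-assoc k l x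
            ; *ₗ-zeroʳ = *ₗ-zeroʳ
            ; *ₗ-distribˡ = λ k (x , _) (y , _) → *ₗ-distribˡ k x y } }
        ; -ᴹ‿cong = -ᴹ‿cong
        ; -ᴹ‿inverse = (λ (x , _) → -ᴹ‿inverseˡ x) , (λ (x , _) → -ᴹ‿inverseʳ x) } }

-- The two-sided ideal of A generated by S.
module _ (A : Ring r ℓr) where
  open Ring A

  data Ideal (S : Pred Carrier p) : Pred Carrier (r ⊔ ℓr ⊔ p) where
    generator : ∀ {f} → S f → Ideal S f
    resp      : ∀ {f g} → f ≈ g → Ideal S f → Ideal S g
    0∈        : Ideal S 0#
    +∈        : ∀ {f g} → Ideal S f → Ideal S g → Ideal S (f + g)
    *ˡ∈       : ∀ h {f} → Ideal S f → Ideal S (h * f)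
    *ʳ∈       : ∀ h {f} → Ideal S f → Ideal S (f * h)

------------------------------------------------------------------------
-- Paths.

data Step : Set where
  up          : Step
  horizontalθ : Step
  horizontalξ : Step
  down        : Step

displacement : Step → ℤ × ℤ
displacement up          = 1ℤ , 1ℤ
displacement horizontalθ = 1ℤ , 0ℤ
displacement horizontalξ = 1ℤ , 0ℤ
displacement down        = 1ℤ , -1ℤ

-- Whether θᵢ, resp. ξᵢ, occurs in the decoration of the i-th step.
hasθ hasξ : Step → Side
hasθ up          = outside
hasθ horizontalθ = inside
hasθ horizontalξ = outside
hasθ down        = inside
hasξ up          = outside
hasξ horizontalθ = outside
hasξ horizontalξ = inside
hasξ down        = inside

vertices : ∀ {n} → ℤ × ℤ → Vec Step n → Vec (ℤ × ℤ) (suc n)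
vertices (a , b) []      = (a , b) ∷ []
vertices (a , b) (s ∷ π) =
  (a , b) ∷ vertices (a ℤ.+ proj₁ (displacement s) , b ℤ.+ proj₂ (displacement s)) π

InΠ≥0 : ∀ {n} → Vec Step n → Set
InΠ≥0 π = All (λ (_ , b) → 0ℤ ℤ.≤ b) (vertices (0ℤ , 0ℤ) π)

InΠ≥0? : ∀ {n} (π : Vec Step n) → Dec (InΠ≥0 π)
InΠ≥0? π = All.all? (λ (_ , b) → 0ℤ ℤ.≤? b) (vertices (0ℤ , 0ℤ) π)

allPaths : ∀ n → List (Vec Step n)
allPaths zero    = [] List.∷ List.[]
allPaths (suc n) = cartesianProductWith _∷_
  (up List.∷ horizontalθ List.∷ horizontalξ List.∷ down List.∷ List.[]) (allPaths n)

Π≥0 : ∀ n → List (Vec Step n)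
Π≥0 n = filter InΠ≥0? (allPaths n)

T S : ∀ {n} → Vec Step n → Subset n
T = Vec.map hasθ
S = Vec.map hasξ

degθ degξ : ∀ {n} → Vec Step n → ℕ
degθ π = ∣ T π ∣
degξ π = ∣ S π ∣

-- χ∉ (lookup T i) is χ(i ∉ T).
χ∉ : Side → ℤ
χ∉ inside  = 0ℤ
χ∉ outside = 1ℤ

-- βFrom b t s T S lists the remaining βᵢ, given β = b at the previous index,
-- whose membership in the two sets is recorded by t and s.
βFrom : ∀ {n} → ℤ → Side → Side → Subset n → Subset n → Vec ℤ n
βFrom b t s []       []       = []
βFrom b t s (t′ ∷ T) (s′ ∷ S) = b′ ∷ βFrom b′ t′ s′ T S
  where
  b′ : ℤ
  b′ = b ℤ.- + 2 ℤ.+ χ∉ t′ ℤ.+ χ∉ t ℤ.+ χ∉ s′ ℤ.+ χ∉ s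

β : ∀ {n} → Subset n → Subset n → Vec ℤ n
β []      []      = []
β (t ∷ T) (s ∷ S) = b ∷ βFrom b t s T S
  where
  b : ℤ
  b = -1ℤ ℤ.+ χ∉ t ℤ.+ χ∉ s

-- (b , T , S) stands for the monomial x^b θ_T ξ_S.
Monomial : ℕ → Set
Monomial n = Vec ℕ n × Subset n × Subset n

B : ∀ n → Pred (Monomial n) 0ℓ
B n (b , T′ , S′) = ∃ λ (π : Vec Step n) →
  InΠ≥0 π × T′ ≡ T π × S′ ≡ S π × Pointwise (λ bᵢ βᵢ → + bᵢ ℤ.≤ βᵢ) b (β T′ S′)

------------------------------------------------------------------------
-- Power series in q, u, v with coefficients in ℕ: F a b c is the
-- coefficient of q^a u^b v^c.

Series : Set
Series = ℕ → ℕ → ℕ → ℕ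

term : ℕ → ℕ → ℕ → Series
term a b c a′ b′ c′ = if (a ≡ᵇ a′) ∧ (b ≡ᵇ b′) ∧ (c ≡ᵇ c′) then 1 else 0

seriesRawSemiring : RawSemiring 0ℓ 0ℓ
seriesRawSemiring = record
  { Carrier = Series
  ; _≈_ = λ F G → ∀ a b c → F a b c ≡ G a b c
  ; _+_ = λ F G a b c → F a b c ℕ.+ G a b c
  ; _*_ = λ F G a b c → Σ≤ a λ i → Σ≤ b λ j → Σ≤ c λ k → F i j k ℕ.* G (a ∸ i) (b ∸ j) (c ∸ k)
  ; 0# = λ _ _ _ → 0
  ; 1# = term 0 0 0 }
  where
  Σ≤ : ℕ → (ℕ → ℕ) → ℕ
  Σ≤ a f = RawMonoidDefs.sum ℕ.+-0-rawMonoid {suc a} (f ∘ toℕ)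

q u v : Series
q = term 1 0 0
u = term 0 1 0
v = term 0 0 1

private
  module Series = RawSemiring seriesRawSemiring
open RawSemiringDefs seriesRawSemiring using () renaming (sum to ∑; product to ∏; _^_ to _^ˢ_)

-- Negative m, for which [m] is the empty sum here, does not occur
-- for the paths in Π≥0.
[_]q : ℤ → Series
[ + m ]q      = ∑ {m} λ k → q ^ˢ toℕ k
[ -[1+ _ ] ]q = Series.0#

stair : ∀ {n} → Vec Step n → Series
stair {n} π = ∏ {n} λ i → [ lookup (β (T π) (S π)) i ℤ.+ 1ℤ ]q

pathSeries : ℕ → Series
pathSeries n = List.foldr Series._+_ Series.0#
  (List.map (λ π → (u ^ˢ degθ π) Series.* (v ^ˢ degξ π) Series.* stair π) (Π≥0 n))

------------------------------------------------------------------------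
-- The ring of polynomials in x, θ, ξ over K and its coinvariant quotient.

data Var (n : ℕ) : Set where
  x θ ξ : Fin n → Var n

data Odd {n : ℕ} : Pred (Var n) 0ℓ where
  θ : ∀ i → Odd (θ i)
  ξ : ∀ i → Odd (ξ i)

module Coinvariants (K : CommutativeRing c ℓ) (n : ℕ) where
  private
    module K = CommutativeRing K

  infix 4 _≈_
  infixl 6 _+_
  infixl 7 _*_
  infix 8 -_

  data Expr : Set c where
    const   : K.Carrier → Expr
    var     : Var n → Expr
    _+_ _*_ : Expr → Expr → Expr
    -_      : Expr → Expr

  -- Equality in the K-algebra presented by the generators x, θ, ξ and
  -- the relations x-comm, odd-anticomm, odd-square.
  data _≈_ : Expr → Expr → Set (c ⊔ ℓ) where
    ≈-refl  : ∀ {f} → f ≈ f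
    ≈-sym   : ∀ {f g} → f ≈ g → g ≈ f
    ≈-trans : ∀ {f g h} → f ≈ g → g ≈ h → f ≈ h

    +-cong : ∀ {f f′ g g′} → f ≈ f′ → g ≈ g′ → f + g ≈ f′ + g′
    *-cong : ∀ {f f′ g g′} → f ≈ f′ → g ≈ g′ → f * g ≈ f′ * g′
    -‿cong : ∀ {f g} → f ≈ g → - f ≈ - g

    +-assoc     : ∀ f g h → (f + g) + h ≈ f + (g + h)
    +-comm      : ∀ f g → f + g ≈ g + f
    +-identityˡ : ∀ f → const K.0# + f ≈ f
    -‿inverseˡ  : ∀ f → - f + f ≈ const K.0#
    *-assoc     : ∀ f g h → (f * g) * h ≈ f * (g * h)
    *-identityˡ : ∀ f → const K.1# * f ≈ f
    distribˡ    : ∀ f g h → f * (g + h) ≈ f * g + f * h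
    distribʳ    : ∀ f g h → (g + h) * f ≈ g * f + h * f

    const-cong    : ∀ {a b} → a K.≈ b → const a ≈ const b
    const-+       : ∀ a b → const (a K.+ b) ≈ const a + const b
    const-*       : ∀ a b → const (a K.* b) ≈ const a * const b
    const-central : ∀ a f → const a * f ≈ f * const a

    x-comm       : ∀ i z → var (x i) * var z ≈ var z * var (x i)
    odd-anticomm : ∀ {y z} → Odd y → Odd z → var y * var z ≈ - (var z * var y)
    odd-square   : ∀ {y} → Odd y → var y * var y ≈ const K.0#

  algebra : Ring c (c ⊔ ℓ)
  algebra = record
    { Carrier = Expr ; _≈_ = _≈_ ; _+_ = _+_ ; _*_ = _*_ ; -_ = -_ ; 0# = const K.0# ; 1# = const K.1#
    ; isRing = record
      { +-isAbelianGroup = record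
        { isGroup = record
          { isMonoid = record
            { isSemigroup = record
              { isMagma = record
                { isEquivalence = record { refl = ≈-refl ; sym = ≈-sym ; trans = ≈-trans }
                ; ∙-cong = +-cong }
              ; assoc = +-assoc }
            ; identity = +-identityˡ , λ f → ≈-trans (+-comm f _) (+-identityˡ f) }
          ; inverse = -‿inverseˡ , λ f → ≈-trans (+-comm f _) (-‿inverseˡ f)
          ; ⁻¹-cong = -‿cong }
        ; comm = +-comm }
      ; *-cong = *-cong
      ; *-assoc = *-assoc
      ; *-identity = *-identityˡ , λ f → ≈-trans (≈-sym (const-central _ f)) (*-identityˡ f)
      ; distrib = distribˡ , distribʳ } }

  private
    module A = Ring algebra
    open RawSemiringDefs (Semiring.rawSemiring A.semiring) using (product; _^_)

  algebraModule : LeftModule K.ring c (c ⊔ ℓ)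
  algebraModule = record
    { Carrierᴹ = Expr ; _≈ᴹ_ = _≈_ ; _+ᴹ_ = _+_ ; _*ₗ_ = λ k f → const k * f
    ; 0ᴹ = const K.0# ; -ᴹ_ = -_
    ; isLeftModule = record
      { isLeftSemimodule = record
        { +ᴹ-isCommutativeMonoid = A.+-isCommutativeMonoid
        ; isPreleftSemimodule = record
          { *ₗ-cong = λ e → *-cong (const-cong e)
          ; *ₗ-zeroˡ = A.zeroˡ
          ; *ₗ-distribʳ = λ f k l → ≈-trans (*-cong (const-+ k l) ≈-refl) (distribʳ f (const k) (const l))
          ; *ₗ-identityˡ = *-identityˡ
          ; *ₗ-assoc = λ k l f → ≈-trans (*-cong (const-* k l) ≈-refl) (*-assoc (const k) (const l) f)
          ; *ₗ-zeroʳ = λ k → A.zeroʳ (const k)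
          ; *ₗ-distribˡ = λ k → distribˡ (const k) } }
      ; -ᴹ‿cong = -‿cong
      ; -ᴹ‿inverse = A.-‿inverse } }

  SignedPermutation : Set
  SignedPermutation = Permutation′ n × (Fin n → Sign)

  signed : Sign → Expr → Expr
  signed Sign.+ f = f
  signed Sign.- f = - f

  -- The signed permutation (σ , ε) sends xᵢ, θᵢ, ξᵢ to
  -- εᵢ x_σ(i), εᵢ θ_σ(i), εᵢ ξ_σ(i).
  act : SignedPermutation → Expr → Expr
  act w       (const k)   = const k
  act (σ , ε) (var (x i)) = signed (ε i) (var (x (σ ⟨$⟩ʳ i)))
  act (σ , ε) (var (θ i)) = signed (ε i) (var (θ (σ ⟨$⟩ʳ i)))
  act (σ , ε) (var (ξ i)) = signed (ε i) (var (ξ (σ ⟨$⟩ʳ i)))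
  act w       (f + g)     = act w f + act w g
  act w       (f * g)     = act w f * act w g
  act w       (- f)       = - act w f

  Invariant : Pred Expr (c ⊔ ℓ)
  Invariant f = ∀ w → act w f ≈ f

  constantTerm : Expr → K.Carrier
  constantTerm (const k) = k
  constantTerm (var _)   = K.0#
  constantTerm (f + g)   = constantTerm f K.+ constantTerm g
  constantTerm (f * g)   = constantTerm f K.* constantTerm g
  constantTerm (- f)     = K.- constantTerm f

  invariantIdeal : Pred Expr (c ⊔ ℓ)
  invariantIdeal = Ideal algebra λ f → Invariant f × constantTerm f K.≈ K.0#

  R : LeftModule K.ring c (c ⊔ ℓ)
  R = quotient algebraModule {P = invariantIdeal} record
    { resp = resp ; 0∈ = 0∈ ; +∈ = +∈ ; *ₗ∈ = λ k → *ˡ∈ (const k) }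

  -- The elements of the algebra homogeneous of x-degree a,
  -- θ-degree b and ξ-degree c.
  data Homogeneous : ℕ → ℕ → ℕ → Pred Expr (c ⊔ ℓ) where
    const : ∀ k → Homogeneous 0 0 0 (const k)
    x     : ∀ i → Homogeneous 1 0 0 (var (x i))
    θ     : ∀ i → Homogeneous 0 1 0 (var (θ i))
    ξ     : ∀ i → Homogeneous 0 0 1 (var (ξ i))
    zero  : ∀ {a b c} → Homogeneous a b c (const K.0#)
    add   : ∀ {a b c f g} → Homogeneous a b c f → Homogeneous a b c g → Homogeneous a b c (f + g)
    mul   : ∀ {a b c a′ b′ c′ f g} → Homogeneous a b c f → Homogeneous a′ b′ c′ g →
            Homogeneous (a ℕ.+ a′) (b ℕ.+ b′) (c ℕ.+ c′) (f * g)
    resp  : ∀ {a b c f g} → f ≈ g → Homogeneous a b c f → Homogeneous a b c g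

  private
    module R = LeftModule R

  R[_,_,_] : ℕ → ℕ → ℕ → LeftModule K.ring (c ⊔ ℓ) (c ⊔ ℓ)
  R[ a , b , c ] = submodule R {P = λ r → ∃ λ f → Homogeneous a b c f × r R.≈ᴹ f} record
    { resp = λ e (f , hf , r≈f) → f , hf , R.≈ᴹ-trans (R.≈ᴹ-sym e) r≈f
    ; 0∈   = const K.0# , zero , R.≈ᴹ-refl
    ; +∈   = λ (f , hf , r≈f) (g , hg , s≈g) → f + g , add hf hg , R.+ᴹ-cong r≈f s≈g
    ; *ₗ∈  = λ k (f , hf , r≈f) → const k * f , mul (const k) hf , R.*ₗ-cong K.refl r≈f }

  IsHilbertSeries : Series → Set (c ⊔ ℓ)
  IsHilbertSeries F = ∀ a b c → HasDimension R[ a , b , c ] (F a b c)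

  monomial : Monomial n → Expr
  monomial (b , T′ , S′) = product (λ i → var (x i) ^ lookup b i)
    * product (λ i → if lookup T′ i then var (θ i) else const K.1#)
    * product (λ i → if lookup S′ i then var (ξ i) else const K.1#)

{-# OPTIONS --safe #-}

-- The substance is that a homogeneous class of degree (a , b , c) in R is a combination of
-- the basis monomials of that degree only, i.e. that the invariant ideal is homogeneous.
-- No projections to components are needed for this: the rescaling x ↦ k x, θ ↦ l θ,
-- ξ ↦ m ξ is a ring endomorphism commuting with the signed permutations, so it descends
-- to R, where it multiplies classes of degree (a , b , c) by k^a l^b m^c.  Comparing the
-- coefficients of a class and of its rescaling in the given basis kills all monomials of
-- another degree, as 2^a ≠ 2^a′ for a ≠ a′ and ℂ is torsion free.  What remains is that
-- pathSeries is the degree generating function of the set B: the path is determined by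
-- the pair (T , S), and stair enumerates the exponents below β (T , S).

module Submission where

open import Defs
open import Level using (Level; _⊔_)
open import Algebra.Bundles using (CommutativeMonoid; CommutativeRing; RawSemiring; Ring; Semiring)
open import Algebra.Module.Bundles using (LeftModule)
import Algebra.Definitions.RawMonoid as RawMonoidDefs
import Algebra.Definitions.RawSemiring as RawSemiringDefs
import Algebra.Properties.AbelianGroup as AbelianGroupProperties
import Algebra.Properties.CommutativeSemigroup as CommutativeSemigroupProperties
import Algebra.Properties.Ring as RingProperties
import Algebra.Properties.Semiring.Mult as SemiringMult
import Algebra.Properties.Semiring.Sum as SemiringSum
import Relation.Binary.Reasoning.MultiSetoid as MultiSetoidReasoning
import Relation.Binary.Reasoning.Setoid as SetoidReasoning
open import Data.Bool.Base using (false; if_then_else_; true)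
import Data.Bool.Properties as Bool
open import Data.Fin.Base using (Fin; suc; toℕ; zero)
open import Data.Fin.Subset using (Subset; inside; outside; ∣_∣)
open import Data.Integer.Base as ℤ using (ℤ; +_; -[1+_]; 1ℤ)
open import Data.List.Base as List using (List; []; _++_; _∷_; applyUpTo; cartesianProductWith;
  concatMap; filter; length; lookup; map; upTo)
open import Data.List.Membership.Propositional using (_∈_; find; lose)
open import Data.List.Membership.Propositional.Properties
  using (∈-cartesianProductWith⁺; ∈-cartesianProductWith⁻; ∈-concatMap⁺;
  ∈-concatMap⁻; ∈-filter⁺; ∈-filter⁻; ∈-lookup; ∈-map⁺; ∈-map⁻; ∈-upTo⁺; ∈-upTo⁻)
import Data.List.Relation.Unary.All as All
import Data.List.Relation.Unary.All.Properties as All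
open import Data.List.Relation.Unary.AllPairs as AllPairs using ([]; _∷_)
import Data.List.Relation.Unary.AllPairs.Properties as AllPairs
open import Data.List.Relation.Unary.Any using (here; index; there)
open import Data.List.Relation.Unary.Any.Properties using (lookup-index)
open import Data.List.Relation.Unary.Unique.Propositional using (Unique)
import Data.List.Relation.Unary.Unique.Propositional.Properties as Unique
open import Data.Nat.Base as ℕ using (NonZero; _<_; _≡ᵇ_; _∸_; suc; zero; ℕ)
import Data.Nat.Properties as ℕ
open import Data.Product.Base using (_,_; _×_; proj₁; proj₂; ∃)
open import Data.Product.Properties using (≡-dec)
open import Data.Rational.Base as ℚ using (0ℚ; 1ℚ; ℚ)
import Data.Rational.Properties as ℚ
import Data.Sign.Base as Sign
open import Data.Vec.Base as Vec using (Vec; []; _∷_)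
import Data.Vec.Properties as Vec
open import Data.Vec.Relation.Binary.Pointwise.Inductive using (Pointwise; []; _∷_)
open import Function.Base using (_∘_; id)
open import Function.Definitions using (Injective)
open import Relation.Binary.Definitions using (DecidableEquality; tri<; tri≈; tri>)
open import Relation.Binary.PropositionalEquality as ≡ using (_≡_; _≢_; cong; cong₂; refl)
open import Relation.Nullary.Decidable using (does; no; yes)
open import Relation.Nullary.Negation using (contradiction; ¬_)
open import Relation.Unary using (Decidable; Pred)

open CommutativeSemigroupProperties ℕ.*-commutativeSemigroup using () renaming (interchange to *-interchange)

-- Finite bases of modules

lookup-injective : ∀ {a} {A : Set a} {xs : List A} → Unique xs → Injective _≡_ _≡_ (lookup xs)
lookup-injective (_ ∷ _)  {zero}  {zero}  _ = refl
lookup-injective (x∉ ∷ _) {zero}  {suc j} e = contradiction e (All.lookup x∉ (∈-lookup j))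
lookup-injective (x∉ ∷ _) {suc i} {zero}  e = contradiction (≡.sym e) (All.lookup x∉ (∈-lookup i))
lookup-injective (_ ∷ u)  {suc i} {suc j} e = cong suc (lookup-injective u e)

module _ {r ℓr m ℓm p : Level} {K : Ring r ℓr} (M : LeftModule K m ℓm)
         {P : Pred (LeftModule.Carrierᴹ M) p} (P-sub : IsSubmodule M P) where
  open LeftModule M using (Carrierᴹ)

  -- The operations of the submodule act on first components, so spanning and independence in it can
  -- be checked in `M`.
  linearCombination-proj₁ : ∀ {k} (a : Fin k → Ring.Carrier K)
    (v : Fin k → LeftModule.Carrierᴹ (submodule M P-sub)) →
    proj₁ (linearCombination (submodule M P-sub) a v) ≡ linearCombination M a (proj₁ ∘ v)
  linearCombination-proj₁ {zero}  a v = refl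
  linearCombination-proj₁ {suc k} a v =
    cong (LeftModule._+ᴹ_ M _) (linearCombination-proj₁ (a ∘ suc) (v ∘ suc))

module Combinations {r ℓr m ℓm i : Level} {K : Ring r ℓr} (M : LeftModule K m ℓm)
                    {I : Set i} (v : I → LeftModule.Carrierᴹ M) where
  open LeftModule M
  private
    module K = Ring K
    open AbelianGroupProperties K.+-abelianGroup using (x∙y⁻¹≈ε⇒x≈y)
    open AbelianGroupProperties +ᴹ-abelianGroup using (identityˡ-unique)
    open CommutativeSemigroupProperties
      (CommutativeMonoid.commutativeSemigroup +ᴹ-commutativeMonoid) using (interchange)
    open SetoidReasoning ≈ᴹ-setoid

  -- Coefficients are functions on `I` and not on positions in `L`, so that the same `c` also serves
  -- for sublists of `L`; only its values on `L` matter.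
  combination : List I → (I → K.Carrier) → Carrierᴹ
  combination L c = linearCombination M (c ∘ lookup L) (v ∘ lookup L)

  combination-cong : ∀ L {c c′} → (∀ z → c z K.≈ c′ z) → combination L c ≈ᴹ combination L c′
  combination-cong []      e = ≈ᴹ-refl
  combination-cong (z ∷ L) e = +ᴹ-cong (*ₗ-cong (e z) ≈ᴹ-refl) (combination-cong L e)

  combination-zero : ∀ L {c} → (∀ {z} → z ∈ L → c z K.≈ K.0#) → combination L c ≈ᴹ 0ᴹ
  combination-zero []      e = ≈ᴹ-refl
  combination-zero (z ∷ L) e = ≈ᴹ-trans
    (+ᴹ-cong (≈ᴹ-trans (*ₗ-cong (e (here refl)) ≈ᴹ-refl) (*ₗ-zeroˡ (v z))) (combination-zero L (e ∘ there)))
    (+ᴹ-identityˡ 0ᴹ)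

  combination-+ : ∀ L c c′ →
    combination L (λ z → c z K.+ c′ z) ≈ᴹ combination L c +ᴹ combination L c′
  combination-+ []      c c′ = ≈ᴹ-sym (+ᴹ-identityˡ 0ᴹ)
  combination-+ (z ∷ L) c c′ =
    ≈ᴹ-trans (+ᴹ-cong (*ₗ-distribʳ (v z) (c z) (c′ z)) (combination-+ L c c′)) (interchange _ _ _ _)

  combination-* : ∀ L k c → combination L (λ z → k K.* c z) ≈ᴹ k *ₗ combination L c
  combination-* []      k c = ≈ᴹ-sym (*ₗ-zeroʳ k)
  combination-* (z ∷ L) k c =
    ≈ᴹ-trans (+ᴹ-cong (*ₗ-assoc k (c z) (v z)) (combination-* L k c)) (≈ᴹ-sym (*ₗ-distribˡ k _ _))

  combination-filter : ∀ {d} {D : Pred I d} (D? : Decidable D) L {c} →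
    (∀ {z} → z ∈ L → ¬ D z → c z K.≈ K.0#) → combination L c ≈ᴹ combination (filter D? L) c
  combination-filter D? []      e = ≈ᴹ-refl
  combination-filter D? (z ∷ L) e with D? z
  ... | yes _  = +ᴹ-congˡ (combination-filter D? L (e ∘ there))
  ... | no ¬Dx = ≈ᴹ-trans
    (+ᴹ-cong (≈ᴹ-trans (*ₗ-cong (e (here refl) ¬Dx) ≈ᴹ-refl) (*ₗ-zeroˡ (v z)))
             (combination-filter D? L (e ∘ there)))
    (+ᴹ-identityˡ _)

  module _ (_≟_ : DecidableEquality I) where

    indicator : I → K.Carrier → I → K.Carrier
    indicator y a z = if does (y ≟ z) then a else K.0#

    indicator-≡ : ∀ y a → indicator y a y K.≈ a
    indicator-≡ y a with y ≟ y
    ... | yes _  = K.refl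
    ... | no y≢y = contradiction refl y≢y

    indicator-≢ : ∀ {y z} a → ¬ y ≡ z → indicator y a z K.≈ K.0#
    indicator-≢ {y} {z} a y≢x with y ≟ z
    ... | yes y≡x = contradiction y≡x y≢x
    ... | no _    = K.refl

    combination-indicator : ∀ {L y} a → Unique L → y ∈ L → combination L (indicator y a) ≈ᴹ a *ₗ v y
    combination-indicator {z ∷ L} a (x∉ ∷ _) (here refl) = ≈ᴹ-trans
      (+ᴹ-cong (*ₗ-cong (indicator-≡ z a) ≈ᴹ-refl)
               (combination-zero L λ z∈ → indicator-≢ a (All.lookup x∉ z∈)))
      (+ᴹ-identityʳ _)
    combination-indicator {z ∷ L} {y} a (x∉ ∷ u) (there y∈) = ≈ᴹ-trans
      (+ᴹ-cong
        (≈ᴹ-trans (*ₗ-cong (indicator-≢ a λ y≡x → All.lookup x∉ y∈ (≡.sym y≡x)) ≈ᴹ-refl) (*ₗ-zeroˡ (v z)))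
        (combination-indicator a u y∈))
      (+ᴹ-identityˡ _)

    -- A family obtained from `spans` may repeat an index. Adding the coefficients of equal indices
    -- turns it into a single function on `I`.
    collect : ∀ {k} → (Fin k → I) → (Fin k → K.Carrier) → I → K.Carrier
    collect {zero}  t a z = K.0#
    collect {suc k} t a z = indicator (t zero) (a zero) z K.+ collect (t ∘ suc) (a ∘ suc) z

    combination-collect : ∀ {L k} → Unique L → (t : Fin k → I) (a : Fin k → K.Carrier) →
      (∀ j → t j ∈ L) → linearCombination M a (v ∘ t) ≈ᴹ combination L (collect t a)
    combination-collect {L} {zero}  u t a t∈ = ≈ᴹ-sym (combination-zero L λ _ → K.refl)
    combination-collect {L} {suc k} u t a t∈ = ≈ᴹ-sym (≈ᴹ-trans
      (combination-+ L (indicator (t zero) (a zero)) (collect (t ∘ suc) (a ∘ suc)))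
      (+ᴹ-cong (combination-indicator (a zero) u (t∈ zero))
               (≈ᴹ-sym (combination-collect u (t ∘ suc) (a ∘ suc) (t∈ ∘ suc)))))

  module FiniteBasis {p} {P : Pred I p} (basis : IsBasis M P v)
                     {L : List I} (L-unique : Unique L) (L⊆P : ∀ {z} → z ∈ L → P z) where
    open IsBasis basis

    -- Independence is applied to the difference of the two coefficient functions; `lookup L` is an
    -- injective family because `L` has no repetitions.
    combination-injective : ∀ {c c′} → combination L c ≈ᴹ combination L c′ →
      ∀ {z} → z ∈ L → c z K.≈ c′ z
    combination-injective {c} {c′} e {z} z∈ = x∙y⁻¹≈ε⇒x≈y (c z) (c′ z)
      (≡.subst (λ z → d z K.≈ K.0#) (≡.sym (lookup-index z∈))
        (independent (lookup L) (lookup-injective L-unique) (λ j → L⊆P (∈-lookup j))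
          (d ∘ lookup L) d-null (index z∈)))
      where
      d : I → K.Carrier
      d y = c y K.- c′ y
      d+c′ : ∀ y → d y K.+ c′ y K.≈ c y
      d+c′ y = K.trans (K.+-assoc _ _ _) (K.trans (K.+-congˡ (K.-‿inverseˡ _)) (K.+-identityʳ _))
      d-null : combination L d ≈ᴹ 0ᴹ
      -- As `d + c′` is `c`, adding the combination of `c′` to that of `d` gives the combination of
      -- `c′` again, and cancellation leaves zero.
      d-null = identityˡ-unique (combination L d) (combination L c′) (begin
        combination L d +ᴹ combination L c′      ≈⟨ combination-+ L d c′ ⟨
        combination L (λ y → d y K.+ c′ y)       ≈⟨ combination-cong L d+c′ ⟩
        combination L c                          ≈⟨ e ⟩
        combination L c′                         ∎)

    -- The hypotheses say that `φ` is diagonal on combinations, with entries `s`, and that `y` is an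
    -- eigenvector with eigenvalue `k`. Expanding `φ y` in two ways and comparing coefficients gives
    -- the equation.
    eigen-coefficient : {φ : Carrierᴹ → Carrierᴹ} {s : I → K.Carrier} →
      (∀ {z y} → z ≈ᴹ y → φ z ≈ᴹ φ y) → (∀ c → φ (combination L c) ≈ᴹ combination L (λ z → c z K.* s z)) →
      ∀ {k y} c → φ y ≈ᴹ k *ₗ y → y ≈ᴹ combination L c → ∀ {z} → z ∈ L → c z K.* s z K.≈ k K.* c z
    eigen-coefficient {φ} {s} φ-cong φ-combination {k} {y} c φy y≈ = combination-injective (begin
      combination L (λ z → c z K.* s z)   ≈⟨ φ-combination c ⟨
      φ (combination L c)                 ≈⟨ φ-cong y≈ ⟨
      φ y                                 ≈⟨ φy ⟩
      k *ₗ y                              ≈⟨ *ₗ-cong K.refl y≈ ⟩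
      k *ₗ combination L c                ≈⟨ combination-* L k c ⟨
      combination L (λ z → k K.* c z)     ∎)

    -- The basis vectors with property `D` lie in the submodule, and `isolate` removes all others
    -- from the expansion of its elements. Independence is inherited from `M`.
    submodule-dimension : DecidableEquality I → (∀ {z} → P z → z ∈ L) →
      ∀ {d q} {D : Pred I d} (D? : Decidable D) {Q : Pred Carrierᴹ q} (Q-sub : IsSubmodule M Q) →
      (∀ {z} → D z → Q (v z)) →
      (∀ {y} c → Q y → y ≈ᴹ combination L c → ∀ {z} → z ∈ L → ¬ D z → c z K.≈ K.0#) →
      HasDimension (submodule M Q-sub) (length (filter D? L))
    submodule-dimension _≟_ P⊆L D? Q-sub D⇒Q isolate = w , record
      { spans = λ (y , Qy) → let (k , t , a , Pt , y≈) = spans y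
                                 c = collect _≟_ t a
                                 y≈c = ≈ᴹ-trans y≈ (combination-collect _≟_ L-unique t a (P⊆L ∘ Pt))
          in _ , (λ j → j) , c ∘ lookup L′ , _
           , ≈ᴹ-trans y≈c (≈ᴹ-trans (combination-filter D? L (isolate c Qy y≈c))
               (≈ᴹ-reflexive (≡.sym (linearCombination-proj₁ M Q-sub (c ∘ lookup L′) w))))
      ; independent = λ t t-inj _ a e → independent (lookup L′ ∘ t)
          (t-inj ∘ lookup-injective (Unique.filter⁺ D? L-unique))
          (λ j → L⊆P (proj₁ (∈-filter⁻ D? {xs = L} (∈-lookup (t j))))) a
          (≈ᴹ-trans (≈ᴹ-reflexive (≡.sym (linearCombination-proj₁ M Q-sub a (w ∘ t)))) e) }
      where
      L′ : List I
      L′ = filter D? L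
      w : Fin (length L′) → LeftModule.Carrierᴹ (submodule M Q-sub)
      w j = v (lookup L′ j) , D⇒Q (proj₂ (∈-filter⁻ D? {xs = L} (∈-lookup j)))

-- The coinvariant ring

Degree : Set
Degree = ℕ × ℕ × ℕ

degree : ∀ {n} → Monomial n → Degree
degree (b , T′ , S′) = Vec.sum b , ∣ T′ ∣ , ∣ S′ ∣

_≟ᵈ_ : DecidableEquality Degree
_≟ᵈ_ = ≡-dec ℕ._≟_ (≡-dec ℕ._≟_ ℕ._≟_)

_≟ᵐ_ : ∀ {n} → DecidableEquality (Monomial n)
_≟ᵐ_ = ≡-dec (Vec.≡-dec ℕ._≟_) (≡-dec (Vec.≡-dec Bool._≟_) (Vec.≡-dec Bool._≟_))

-- (k , l , m) ^ᵈ (a , b , c) is the factor by which x ↦ k x, θ ↦ l θ, ξ ↦ m ξ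
-- scales the elements of degree (a , b , c).
_^ᵈ_ : Degree → Degree → ℕ
(k , l , m) ^ᵈ (a , b , c) = k ℕ.^ a ℕ.* (l ℕ.^ b ℕ.* m ℕ.^ c)

^ᵈ-+ : ∀ s {a b c a′ b′ c′} →
  s ^ᵈ (a ℕ.+ a′ , b ℕ.+ b′ , c ℕ.+ c′) ≡ s ^ᵈ (a , b , c) ℕ.* s ^ᵈ (a′ , b′ , c′)
^ᵈ-+ (k , l , m) {a} {b} {c} {a′} {b′} {c′}
  rewrite ℕ.^-distribˡ-+-* k a a′ | ℕ.^-distribˡ-+-* l b b′ | ℕ.^-distribˡ-+-* m c c′
        | *-interchange (l ℕ.^ b) (l ℕ.^ b′) (m ℕ.^ c) (m ℕ.^ c′)
  = *-interchange (k ℕ.^ a) (k ℕ.^ a′) _ _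

2^-injective : ∀ {a b} → 2 ℕ.^ a ≡ 2 ℕ.^ b → a ≡ b
2^-injective {a} {b} e with ℕ.<-cmp a b
... | tri< a<b _ _ = contradiction e (ℕ.<⇒≢ (ℕ.^-monoʳ-< 2 (ℕ.s≤s (ℕ.s≤s ℕ.z≤n)) a<b))
... | tri≈ _ a≡b _ = a≡b
... | tri> _ _ b<a = contradiction (≡.sym e) (ℕ.<⇒≢ (ℕ.^-monoʳ-< 2 (ℕ.s≤s (ℕ.s≤s ℕ.z≤n)) b<a))

-- Doubling one kind of variable, in whose degree `d` and `e` differ, and fixing the other two kinds
-- reduces the claim to injectivity of the powers of 2.
^ᵈ-separates : ∀ d e → d ≢ e → ∃ λ s → s ^ᵈ d ≢ s ^ᵈ e
^ᵈ-separates (a , b , c) (a′ , b′ , c′) d≢e with a ℕ.≟ a′ | b ℕ.≟ b′ | c ℕ.≟ c′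
... | no a≢a′ | _ | _ = (2 , 1 , 1) , λ e → a≢a′ (2^-injective (begin
  2 ℕ.^ a                            ≡⟨ at a b c ⟨
  (2 , 1 , 1) ^ᵈ (a , b , c)         ≡⟨ e ⟩
  (2 , 1 , 1) ^ᵈ (a′ , b′ , c′)      ≡⟨ at a′ b′ c′ ⟩
  2 ℕ.^ a′                           ∎))
  where
  open ≡.≡-Reasoning
  at : ∀ a b c → (2 , 1 , 1) ^ᵈ (a , b , c) ≡ 2 ℕ.^ a
  at a b c rewrite ℕ.^-zeroˡ b | ℕ.^-zeroˡ c = ℕ.*-identityʳ _
... | yes _ | no b≢b′ | _ = (1 , 2 , 1) , λ e → b≢b′ (2^-injective (begin
  2 ℕ.^ b                            ≡⟨ at a b c ⟨
  (1 , 2 , 1) ^ᵈ (a , b , c)         ≡⟨ e ⟩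
  (1 , 2 , 1) ^ᵈ (a′ , b′ , c′)      ≡⟨ at a′ b′ c′ ⟩
  2 ℕ.^ b′                           ∎))
  where
  open ≡.≡-Reasoning
  at : ∀ a b c → (1 , 2 , 1) ^ᵈ (a , b , c) ≡ 2 ℕ.^ b
  at a b c rewrite ℕ.^-zeroˡ a | ℕ.^-zeroˡ c = ≡.trans (ℕ.*-identityˡ _) (ℕ.*-identityʳ _)
... | yes _ | yes _ | no c≢c′ = (1 , 1 , 2) , λ e → c≢c′ (2^-injective (begin
  2 ℕ.^ c                            ≡⟨ at a b c ⟨
  (1 , 1 , 2) ^ᵈ (a , b , c)         ≡⟨ e ⟩
  (1 , 1 , 2) ^ᵈ (a′ , b′ , c′)      ≡⟨ at a′ b′ c′ ⟩
  2 ℕ.^ c′                           ∎))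
  where
  open ≡.≡-Reasoning
  at : ∀ a b c → (1 , 1 , 2) ^ᵈ (a , b , c) ≡ 2 ℕ.^ c
  at a b c rewrite ℕ.^-zeroˡ a | ℕ.^-zeroˡ b = ≡.trans (ℕ.*-identityˡ _) (ℕ.*-identityˡ _)
... | yes refl | yes refl | yes refl = contradiction refl d≢e

-- Torsion-free coefficient rings

module _ {c ℓ} (K : CommutativeRing c ℓ) where
  private
    module K = CommutativeRing K
  open SemiringMult K.semiring using () renaming (_×_ to _×ᴷ_)

  TorsionFree : Set (c ⊔ ℓ)
  TorsionFree = ∀ k z → suc k ×ᴷ z K.≈ K.0# → z K.≈ K.0#

module _ {c ℓ} (K : CommutativeRing c ℓ) (torsionFree : TorsionFree K) where
  private
    module K = CommutativeRing K
  open SemiringMult K.semiring using (×-homo-+) renaming (_×_ to _×ᴷ_)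
  open RingProperties K.ring using (+-identityʳ-unique)
  open SetoidReasoning K.setoid

  private
    -- With `l = k + suc o`, cancelling `k ×ᴷ z` leaves `suc o ×ᴷ z ≈ 0`, a positive multiple of
    -- `z`.
    cancel-< : ∀ {k l} z → k < l → k ×ᴷ z K.≈ l ×ᴷ z → z K.≈ K.0#
    cancel-< {k} z k<l e with ℕ.m≤n⇒∃[o]m+o≡n k<l
    ... | o , refl = torsionFree o z (+-identityʳ-unique (k ×ᴷ z) (suc o ×ᴷ z) (begin
      k ×ᴷ z K.+ suc o ×ᴷ z    ≈⟨ ×-homo-+ z k (suc o) ⟨
      (k ℕ.+ suc o) ×ᴷ z      ≡⟨ cong (_×ᴷ z) (ℕ.+-suc k o) ⟩
      suc (k ℕ.+ o) ×ᴷ z      ≈⟨ e ⟨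
      k ×ᴷ z                  ∎))

  ×-cancel : ∀ {k l} z → k ≢ l → k ×ᴷ z K.≈ l ×ᴷ z → z K.≈ K.0#
  ×-cancel {k} {l} z k≢l e with ℕ.<-cmp k l
  ... | tri< k<l _ _ = cancel-< z k<l e
  ... | tri≈ _ k≡l _ = contradiction k≡l k≢l
  ... | tri> _ _ l<k = cancel-< z l<k (K.sym e)

-- Rescaling of the variables

module Scaling {c ℓ} (K : CommutativeRing c ℓ) (n : ℕ) where
  open Coinvariants K n
  private
    module K = CommutativeRing K
    module A = Ring algebra
    module R = LeftModule R
  open SemiringMult K.semiring using (×1-homo-*) renaming (_×_ to _×ᴷ_)
  open RawSemiringDefs (Semiring.rawSemiring A.semiring) using (product; _^_)
  open RingProperties algebra using (-‿distribʳ-*)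
  open MultiSetoidReasoning

  const-interchange : ∀ k l f g → (const k * f) * (const l * g) ≈ const (k K.* l) * (f * g)
  const-interchange k l f g = begin⟨ A.setoid ⟩
    (const k * f) * (const l * g)    ≈⟨ *-assoc (const k) f (const l * g) ⟩
    const k * (f * (const l * g))    ≈⟨ *-cong ≈-refl (≈-sym (*-assoc f (const l) g)) ⟩
    const k * ((f * const l) * g)    ≈⟨ *-cong ≈-refl (*-cong (≈-sym (const-central l f)) ≈-refl) ⟩
    const k * ((const l * f) * g)    ≈⟨ *-cong ≈-refl (*-assoc (const l) f g) ⟩
    const k * (const l * (f * g))    ≈⟨ ≈-sym (*-assoc (const k) (const l) (f * g)) ⟩
    (const k * const l) * (f * g)    ≈⟨ *-cong (≈-sym (const-* k l)) ≈-refl ⟩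
    const (k K.* l) * (f * g)        ∎

  module _ (s : Degree) where

    multiplier : Var n → ℕ
    multiplier (x _) = proj₁ s
    multiplier (θ _) = proj₁ (proj₂ s)
    multiplier (ξ _) = proj₂ (proj₂ s)

    scaleVar : Var n → Expr
    scaleVar z = const (multiplier z ×ᴷ K.1#) * var z

    scale : Expr → Expr
    scale (const k) = const k
    scale (var z)   = scaleVar z
    scale (f + g)   = scale f + scale g
    scale (f * g)   = scale f * scale g
    scale (- f)     = - scale f

    scaleVar-* : ∀ y z → scaleVar y * scaleVar z
      ≈ const (multiplier y ×ᴷ K.1# K.* multiplier z ×ᴷ K.1#) * (var y * var z)
    scaleVar-* y z = const-interchange _ _ _ _

    -- Only the three relations between variables need an argument: each is homogeneous in every
    -- variable it contains, so rescaling multiplies both of its sides by the same constant.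
    scale-cong : ∀ {f g} → f ≈ g → scale f ≈ scale g
    scale-cong ≈-refl              = ≈-refl
    scale-cong (≈-sym e)           = ≈-sym (scale-cong e)
    scale-cong (≈-trans e e′)      = ≈-trans (scale-cong e) (scale-cong e′)
    scale-cong (+-cong e e′)       = +-cong (scale-cong e) (scale-cong e′)
    scale-cong (*-cong e e′)       = *-cong (scale-cong e) (scale-cong e′)
    scale-cong (-‿cong e)          = -‿cong (scale-cong e)
    scale-cong (+-assoc f g h)     = +-assoc _ _ _
    scale-cong (+-comm f g)        = +-comm _ _
    scale-cong (+-identityˡ f)     = +-identityˡ _
    scale-cong (-‿inverseˡ f)      = -‿inverseˡ _
    scale-cong (*-assoc f g h)     = *-assoc _ _ _
    scale-cong (*-identityˡ f)     = *-identityˡ _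
    scale-cong (distribˡ f g h)    = distribˡ _ _ _
    scale-cong (distribʳ f g h)    = distribʳ _ _ _
    scale-cong (const-cong e)      = const-cong e
    scale-cong (const-+ a b)       = const-+ a b
    scale-cong (const-* a b)       = const-* a b
    scale-cong (const-central a f) = const-central a _
    scale-cong (x-comm i z) = begin⟨ A.setoid ⟩
      scaleVar (x i) * scaleVar z         ≈⟨ scaleVar-* (x i) z ⟩
      const _ * (var (x i) * var z)       ≈⟨ *-cong (const-cong (K.*-comm _ _)) (x-comm i z) ⟩
      const _ * (var z * var (x i))       ≈⟨ ≈-sym (scaleVar-* z (x i)) ⟩
      scaleVar z * scaleVar (x i)         ∎
    scale-cong (odd-anticomm {y} {z} oy oz) = begin⟨ A.setoid ⟩
      scaleVar y * scaleVar z             ≈⟨ scaleVar-* y z ⟩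
      const _ * (var y * var z)           ≈⟨ *-cong (const-cong (K.*-comm _ _)) (odd-anticomm oy oz) ⟩
      const _ * - (var z * var y)         ≈⟨ ≈-sym (-‿distribʳ-* _ _) ⟩
      - (const _ * (var z * var y))       ≈⟨ -‿cong (≈-sym (scaleVar-* z y)) ⟩
      - (scaleVar z * scaleVar y)         ∎
    scale-cong (odd-square {y} oy) = begin⟨ A.setoid ⟩
      scaleVar y * scaleVar y             ≈⟨ scaleVar-* y y ⟩
      const _ * (var y * var y)           ≈⟨ *-cong ≈-refl (odd-square oy) ⟩
      const _ * const K.0#                ≈⟨ A.zeroʳ _ ⟩
      const K.0#                          ∎

    scale-signed : ∀ ε z → const (multiplier z ×ᴷ K.1#) * signed ε (var z) ≈ scale (signed ε (var z))
    scale-signed Sign.+ z = ≈-refl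
    scale-signed Sign.- z = ≈-sym (-‿distribʳ-* _ _)

    -- A signed permutation preserves the kind of a variable, and `multiplier` depends on the kind
    -- alone, not on the index.
    act-scale : ∀ w f → act w (scale f) ≈ scale (act w f)
    act-scale w       (const k)   = ≈-refl
    act-scale (σ , ε) (var (x i)) = scale-signed (ε i) (x _)
    act-scale (σ , ε) (var (θ i)) = scale-signed (ε i) (θ _)
    act-scale (σ , ε) (var (ξ i)) = scale-signed (ε i) (ξ _)
    act-scale w       (f + g)     = +-cong (act-scale w f) (act-scale w g)
    act-scale w       (f * g)     = *-cong (act-scale w f) (act-scale w g)
    act-scale w       (- f)       = -‿cong (act-scale w f)

    constantTerm-scale : ∀ f → constantTerm (scale f) K.≈ constantTerm f
    constantTerm-scale (const k) = K.refl
    constantTerm-scale (var z)   = K.zeroʳ _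
    constantTerm-scale (f + g)   = K.+-cong (constantTerm-scale f) (constantTerm-scale g)
    constantTerm-scale (f * g)   = K.*-cong (constantTerm-scale f) (constantTerm-scale g)
    constantTerm-scale (- f)     = K.-‿cong (constantTerm-scale f)

    -- By `act-scale` invariants are sent to invariants, and constant terms are kept, so generators
    -- go to generators.
    scale-invariantIdeal : ∀ {f} → invariantIdeal f → invariantIdeal (scale f)
    scale-invariantIdeal (generator {f} (inv , ct)) = generator
      ( (λ w → ≈-trans (act-scale w f) (scale-cong (inv w)))
      , K.trans (constantTerm-scale f) ct )
    scale-invariantIdeal (resp e h)   = resp (scale-cong e) (scale-invariantIdeal h)
    scale-invariantIdeal 0∈           = 0∈
    scale-invariantIdeal (+∈ h h′)    = +∈ (scale-invariantIdeal h) (scale-invariantIdeal h′)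
    scale-invariantIdeal (*ˡ∈ g h)    = *ˡ∈ (scale g) (scale-invariantIdeal h)
    scale-invariantIdeal (*ʳ∈ g h)    = *ʳ∈ (scale g) (scale-invariantIdeal h)

    scale-homogeneous : ∀ {a b c f} → Homogeneous a b c f →
      scale f ≈ const ((s ^ᵈ (a , b , c)) ×ᴷ K.1#) * f
    -- In degree `(0 , 0 , 0)` the factor is `1 ×ᴷ K.1#`, which unfolds to `K.1# + K.0#`.
    scale-homogeneous (const k) =
      ≈-sym (≈-trans (*-cong (const-cong (K.+-identityʳ K.1#)) ≈-refl) (*-identityˡ _))
    scale-homogeneous (x i) = A.reflexive (cong (λ m → const (m ×ᴷ K.1#) * var (x i)) (≡.sym eq))
      where
      eq : s ^ᵈ (1 , 0 , 0) ≡ proj₁ s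
      eq = ≡.trans (ℕ.*-identityʳ _) (ℕ.*-identityʳ _)
    scale-homogeneous (θ i) = A.reflexive (cong (λ m → const (m ×ᴷ K.1#) * var (θ i)) (≡.sym eq))
      where
      eq : s ^ᵈ (0 , 1 , 0) ≡ proj₁ (proj₂ s)
      eq = ≡.trans (ℕ.*-identityˡ _) (≡.trans (ℕ.*-identityʳ _) (ℕ.*-identityʳ _))
    scale-homogeneous (ξ i) = A.reflexive (cong (λ m → const (m ×ᴷ K.1#) * var (ξ i)) (≡.sym eq))
      where
      eq : s ^ᵈ (0 , 0 , 1) ≡ proj₂ (proj₂ s)
      eq = ≡.trans (ℕ.*-identityˡ _) (≡.trans (ℕ.*-identityˡ _) (ℕ.*-identityʳ _))
    scale-homogeneous zero       = ≈-sym (A.zeroʳ _)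
    scale-homogeneous (add h h′) =
      ≈-trans (+-cong (scale-homogeneous h) (scale-homogeneous h′)) (≈-sym (distribˡ _ _ _))
    scale-homogeneous (mul {a} {b} {c} {a′} {b′} {c′} h h′) = ≈-trans
      (*-cong (scale-homogeneous h) (scale-homogeneous h′))
      (≈-trans (const-interchange _ _ _ _) (*-cong (const-cong (K.trans
        (K.sym (×1-homo-* (s ^ᵈ (a , b , c)) (s ^ᵈ (a′ , b′ , c′))))
        (K.reflexive (cong (_×ᴷ K.1#) (≡.sym (^ᵈ-+ s {a} {b} {c} {a′} {b′} {c′})))))) ≈-refl))
    scale-homogeneous (resp e h) =
      ≈-trans (≈-sym (scale-cong e)) (≈-trans (scale-homogeneous h) (*-cong ≈-refl e))

    -- Equality in `R` is membership of `f + - g` in the ideal, and `scale` commutes with sums and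
    -- negation by definition.
    scale-R-cong : ∀ {f g} → f R.≈ᴹ g → scale f R.≈ᴹ scale g
    scale-R-cong = scale-invariantIdeal

  ≈⇒≈ᴹ : ∀ {f g} → f ≈ g → f R.≈ᴹ g
  ≈⇒≈ᴹ {f} {g} e = resp (≈-sym (≈-trans (+-cong e ≈-refl) (A.-‿inverseʳ g))) 0∈

  private
    -- The renaming `f` is there for the induction: the product is shortened by its first factor
    -- while the variables stay those of the ring with `n` indices.
    powers-homogeneous : ∀ {k} (f : Fin k → Fin n) (b : Vec ℕ k) →
      Homogeneous (Vec.sum b) 0 0 (product λ i → var (x (f i)) ^ Vec.lookup b i)
    powers-homogeneous f []      = const K.1#
    powers-homogeneous f (e ∷ b) = mul (power e) (powers-homogeneous (f ∘ suc) b)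
      where
      power : ∀ e → Homogeneous e 0 0 (var (x (f zero)) ^ e)
      power zero    = const K.1#
      power (suc e) = mul (x (f zero)) (power e)

    θ-homogeneous : ∀ {k} (f : Fin k → Fin n) (T′ : Subset k) →
      Homogeneous 0 ∣ T′ ∣ 0 (product λ i → if Vec.lookup T′ i then var (θ (f i)) else const K.1#)
    θ-homogeneous f []            = const K.1#
    θ-homogeneous f (inside ∷ T′)  = mul (θ (f zero)) (θ-homogeneous (f ∘ suc) T′)
    θ-homogeneous f (outside ∷ T′) = mul (const K.1#) (θ-homogeneous (f ∘ suc) T′)

    ξ-homogeneous : ∀ {k} (f : Fin k → Fin n) (S′ : Subset k) →
      Homogeneous 0 0 ∣ S′ ∣ (product λ i → if Vec.lookup S′ i then var (ξ (f i)) else const K.1#)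
    ξ-homogeneous f []            = const K.1#
    ξ-homogeneous f (inside ∷ S′)  = mul (ξ (f zero)) (ξ-homogeneous (f ∘ suc) S′)
    ξ-homogeneous f (outside ∷ S′) = mul (const K.1#) (ξ-homogeneous (f ∘ suc) S′)

  monomial-homogeneous : ∀ (m : Monomial n) → let (a , b , c) = degree m in
    Homogeneous a b c (monomial m)
  monomial-homogeneous (e , T′ , S′)
    -- Multiplying the three factors yields degrees padded with zeros, which the rewriting removes.
    with h ← mul (mul (powers-homogeneous (λ i → i) e) (θ-homogeneous (λ i → i) T′)) (ξ-homogeneous (λ i → i) S′)
    rewrite ℕ.+-identityʳ (Vec.sum e) | ℕ.+-identityʳ (Vec.sum e) | ℕ.+-identityʳ ∣ T′ ∣ = h

  -- These are the closure proofs from the definition of `R[_,_,_]`, so that the resulting submodule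
  -- is `R[ a , b , c ]` definitionally.
  components-isSubmodule : ∀ a b c → IsSubmodule R λ r → ∃ λ f → Homogeneous a b c f × r R.≈ᴹ f
  components-isSubmodule a b c = record
    { resp = λ e (f , hf , r≈f) → f , hf , R.≈ᴹ-trans (R.≈ᴹ-sym e) r≈f
    ; 0∈   = const K.0# , zero , R.≈ᴹ-refl
    ; +∈   = λ (f , hf , r≈f) (g , hg , s≈g) → f + g , add hf hg , R.+ᴹ-cong r≈f s≈g
    ; *ₗ∈  = λ k (f , hf , r≈f) → const k * f , mul (const k) hf , R.*ₗ-cong K.refl r≈f }

  -- Coefficients of homogeneous classes

  open Combinations R monomial

  -- `scale` fixes constants, hence is linear, and every monomial is homogeneous, hence an
  -- eigenvector.
  scale-combination : ∀ s L c →
    scale s (combination L c) R.≈ᴹ combination L (λ m → c m K.* ((s ^ᵈ degree m) ×ᴷ K.1#))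
  scale-combination s []      c = R.≈ᴹ-refl
  scale-combination s (m ∷ L) c = R.+ᴹ-cong
    (≈⇒≈ᴹ (≈-trans (*-cong ≈-refl (scale-homogeneous s (monomial-homogeneous m)))
      (≈-trans (≈-sym (*-assoc _ _ _)) (*-cong (≈-sym (const-* _ _)) ≈-refl))))
    (scale-combination s L c)

  module _ (torsionFree : TorsionFree K) {p} {P : Monomial n → Set p} (basis : IsBasis R P monomial)
           {L : List (Monomial n)} (L-unique : Unique L)
           (L⊆P : ∀ {m} → m ∈ L → P m) (P⊆L : ∀ {m} → P m → m ∈ L) where
    open FiniteBasis basis L-unique L⊆P
    open SemiringMult K.semiring using (×-comm-*; ×-assoc-*; ×-congʳ)

    -- For a scaling `s` that separates the two degrees, comparing coefficients shows that two
    -- different integer multiples of `k m` agree, so `k m` vanishes.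
    homogeneous-coefficient : ∀ {a b c r f} → Homogeneous a b c f → r R.≈ᴹ f →
      ∀ k → r R.≈ᴹ combination L k → ∀ {m} → m ∈ L → ¬ degree m ≡ (a , b , c) → k m K.≈ K.0#
    homogeneous-coefficient {a} {b} {c} {r} {f} hf r≈f k r≈ {m} m∈ ≢ with ^ᵈ-separates (degree m) (a , b , c) ≢
    ... | s , s≢ = ×-cancel K torsionFree (k m) s≢ (begin⟨ K.setoid ⟩
      (s ^ᵈ degree m) ×ᴷ k m                   ≈⟨ ×-congʳ (s ^ᵈ degree m) (K.*-identityʳ (k m)) ⟨
      (s ^ᵈ degree m) ×ᴷ (k m K.* K.1#)        ≈⟨ ×-comm-* (s ^ᵈ degree m) (k m) K.1# ⟨
      k m K.* ((s ^ᵈ degree m) ×ᴷ K.1#)        ≈⟨ eigen ⟩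
      ((s ^ᵈ (a , b , c)) ×ᴷ K.1#) K.* k m     ≈⟨ ×-assoc-* (s ^ᵈ (a , b , c)) K.1# (k m) ⟩
      (s ^ᵈ (a , b , c)) ×ᴷ (K.1# K.* k m)     ≈⟨ ×-congʳ (s ^ᵈ (a , b , c)) (K.*-identityˡ (k m)) ⟩
      (s ^ᵈ (a , b , c)) ×ᴷ k m                ∎)
      where
      -- The representative `r` is not itself assumed homogeneous; it is an eigenvector in `R`
      -- because it is congruent to `f`.
      eigen = eigen-coefficient (scale-R-cong s) (scale-combination s L) k
        (R.≈ᴹ-trans (scale-R-cong s r≈f) (R.≈ᴹ-trans (≈⇒≈ᴹ (scale-homogeneous s hf))
          (R.*ₗ-cong K.refl (R.≈ᴹ-sym r≈f)))) r≈ m∈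

    homogeneous-dimension : ∀ a b c →
      HasDimension R[ a , b , c ] (length (filter (λ m → degree m ≟ᵈ (a , b , c)) L))
    homogeneous-dimension a b c = submodule-dimension _≟ᵐ_ P⊆L (λ m → degree m ≟ᵈ (a , b , c))
      (components-isSubmodule a b c) (λ { {m} refl → monomial m , monomial-homogeneous m , R.≈ᴹ-refl })
      (λ { k (f , hf , r≈f) r≈ → homogeneous-coefficient hf r≈f k r≈ })

-- Generating functions

open RawSemiring seriesRawSemiring using () renaming (_≈_ to _≈ˢ_; _+_ to _+ˢ_; _*_ to _*ˢ_; 0# to 0ˢ)
open RawSemiringDefs seriesRawSemiring using () renaming (sum to ∑; product to ∏; _^_ to _^ˢ_)

private
  module ℕSum = SemiringSum ℕ.+-*-semiring

infixl 6 _+ᵈ_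
_+ᵈ_ : Degree → Degree → Degree
(a , b , c) +ᵈ (a′ , b′ , c′) = a ℕ.+ a′ , b ℕ.+ b′ , c ℕ.+ c′

infixr 7 _×ᵈ_
_×ᵈ_ : ℕ → Degree → Degree
m ×ᵈ (a , b , c) = m ℕ.* a , m ℕ.* b , m ℕ.* c

termᵈ : Degree → Series
termᵈ (a , b , c) = term a b c

≈ˢ-trans : ∀ {F G H} → F ≈ˢ G → G ≈ˢ H → F ≈ˢ H
≈ˢ-trans e e′ a b c = ≡.trans (e a b c) (e′ a b c)

+ˢ-cong : ∀ {F F′ G G′} → F ≈ˢ F′ → G ≈ˢ G′ → (F +ˢ G) ≈ˢ (F′ +ˢ G′)
+ˢ-cong e e′ a b c = cong₂ ℕ._+_ (e a b c) (e′ a b c)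

-- This unfolds to the sum used inside `seriesRawSemiring`, so a coefficient of `F *ˢ G` is a `Σ≤³`
-- by definition.
Σ≤ : ℕ → (ℕ → ℕ) → ℕ
Σ≤ n f = ℕSum.sum {suc n} (f ∘ toℕ)

Σ≤-cong : ∀ {f g} n → (∀ i → f i ≡ g i) → Σ≤ n f ≡ Σ≤ n g
Σ≤-cong n e = ℕSum.sum-cong-≗ {suc n} (e ∘ toℕ)

Σ≤-+ : ∀ n f g → Σ≤ n (λ i → f i ℕ.+ g i) ≡ Σ≤ n f ℕ.+ Σ≤ n g
Σ≤-+ n f g = ℕSum.∑-distrib-+ {suc n} (f ∘ toℕ) (g ∘ toℕ)

Σ≤-0 : ∀ n → Σ≤ n (λ _ → 0) ≡ 0
Σ≤-0 n = ℕSum.sum-replicate-zero (suc n)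

Σ≤-*ˡ : ∀ n k f → Σ≤ n (λ i → k ℕ.* f i) ≡ k ℕ.* Σ≤ n f
Σ≤-*ˡ n k f = ≡.sym (ℕSum.*-distribˡ-sum {suc n} k (f ∘ toℕ))

Σ≤-*ʳ : ∀ n k f → Σ≤ n (λ i → f i ℕ.* k) ≡ Σ≤ n f ℕ.* k
Σ≤-*ʳ n k f = ≡.sym (ℕSum.*-distribʳ-sum {suc n} k (f ∘ toℕ))

Σ≤³ : ℕ → ℕ → ℕ → Series → ℕ
Σ≤³ a b c F = Σ≤ a λ i → Σ≤ b λ j → Σ≤ c λ k → F i j k

Σ≤³-cong : ∀ {F G} a b c → F ≈ˢ G → Σ≤³ a b c F ≡ Σ≤³ a b c G
Σ≤³-cong a b c e = Σ≤-cong a λ i → Σ≤-cong b λ j → Σ≤-cong c λ k → e i j k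

Σ≤³-+ : ∀ a b c F G → Σ≤³ a b c (F +ˢ G) ≡ Σ≤³ a b c F ℕ.+ Σ≤³ a b c G
Σ≤³-+ a b c F G = ≡.trans
  (Σ≤-cong a λ i → ≡.trans (Σ≤-cong b λ j → Σ≤-+ c (F i j) (G i j)) (Σ≤-+ b (λ j → Σ≤ c (F i j)) (λ j → Σ≤ c (G i j))))
  (Σ≤-+ a (λ i → Σ≤ b λ j → Σ≤ c (F i j)) (λ i → Σ≤ b λ j → Σ≤ c (G i j)))

Σ≤³-0 : ∀ a b c → Σ≤³ a b c 0ˢ ≡ 0
Σ≤³-0 a b c = ≡.trans
  (Σ≤-cong a λ i → ≡.trans (Σ≤-cong b λ j → Σ≤-0 c) (Σ≤-0 b)) (Σ≤-0 a)

Σ≤³-* : ∀ a b c f g h →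
  Σ≤³ a b c (λ i j k → f i ℕ.* (g j ℕ.* h k)) ≡ Σ≤ a f ℕ.* (Σ≤ b g ℕ.* Σ≤ c h)
Σ≤³-* a b c f g h = ≡.trans
  (Σ≤-cong a λ i → ≡.trans
    (Σ≤-cong b λ j → ≡.trans (Σ≤-*ˡ c (f i) (λ k → g j ℕ.* h k)) (cong (f i ℕ.*_) (Σ≤-*ˡ c (g j) h)))
    (≡.trans (Σ≤-*ˡ b (f i) (λ j → g j ℕ.* Σ≤ c h)) (cong (f i ℕ.*_) (Σ≤-*ʳ b (Σ≤ c h) g))))
  (Σ≤-*ʳ a (Σ≤ b g ℕ.* Σ≤ c h) f)

summand : Series → Series → ℕ → ℕ → ℕ → Series
summand F G a b c i j k = F i j k ℕ.* G (a ∸ i) (b ∸ j) (c ∸ k)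

*ˢ-cong : ∀ {F F′ G G′} → F ≈ˢ F′ → G ≈ˢ G′ → (F *ˢ G) ≈ˢ (F′ *ˢ G′)
*ˢ-cong e e′ a b c = Σ≤³-cong a b c λ i j k → cong₂ ℕ._*_ (e i j k) (e′ (a ∸ i) (b ∸ j) (c ∸ k))

*ˢ-distribʳ : ∀ F F′ G → ((F +ˢ F′) *ˢ G) ≈ˢ ((F *ˢ G) +ˢ (F′ *ˢ G))
*ˢ-distribʳ F F′ G a b c = ≡.trans
  (Σ≤³-cong a b c λ i j k → ℕ.*-distribʳ-+ (G (a ∸ i) (b ∸ j) (c ∸ k)) (F i j k) (F′ i j k))
  (Σ≤³-+ a b c (summand F G a b c) (summand F′ G a b c))

*ˢ-distribˡ : ∀ F G G′ → (F *ˢ (G +ˢ G′)) ≈ˢ ((F *ˢ G) +ˢ (F *ˢ G′))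
*ˢ-distribˡ F G G′ a b c = ≡.trans
  (Σ≤³-cong a b c λ i j k → ℕ.*-distribˡ-+ (F i j k) (G (a ∸ i) (b ∸ j) (c ∸ k)) (G′ (a ∸ i) (b ∸ j) (c ∸ k)))
  (Σ≤³-+ a b c (summand F G a b c) (summand F G′ a b c))

*ˢ-zeroˡ : ∀ G → (0ˢ *ˢ G) ≈ˢ 0ˢ
*ˢ-zeroˡ G a b c = Σ≤³-0 a b c

*ˢ-zeroʳ : ∀ F → (F *ˢ 0ˢ) ≈ˢ 0ˢ
*ˢ-zeroʳ F a b c = ≡.trans (Σ≤³-cong a b c λ i j k → ℕ.*-zeroʳ (F i j k)) (Σ≤³-0 a b c)

δ : ℕ → ℕ → ℕ
δ m n = if m ≡ᵇ n then 1 else 0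

δ-refl : ∀ m → δ m m ≡ 1
δ-refl zero    = refl
δ-refl (suc m) = δ-refl m

δ-≢ : ∀ {m n} → m ≢ n → δ m n ≡ 0
δ-≢ {zero}  {zero}  m≢n = contradiction refl m≢n
δ-≢ {zero}  {suc n} m≢n = refl
δ-≢ {suc m} {zero}  m≢n = refl
δ-≢ {suc m} {suc n} m≢n = δ-≢ {m} {n} (m≢n ∘ cong suc)

-- In one variable, this is the product rule for powers, read off at exponent `n`. For `m = 0` only
-- the summand `i = 0` survives; otherwise that summand vanishes and the rest is the sum for smaller
-- `m` and `n`.
δ-convolution : ∀ m m′ n → Σ≤ n (λ i → δ m i ℕ.* δ m′ (n ∸ i)) ≡ δ (m ℕ.+ m′) n
δ-convolution zero m′ n = ≡.trans
  (cong₂ ℕ._+_ (ℕ.+-identityʳ (δ m′ n)) (ℕSum.sum-replicate-zero n)) (ℕ.+-identityʳ (δ m′ n))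
δ-convolution (suc m) m′ zero    = refl
δ-convolution (suc m) m′ (suc n) = δ-convolution m m′ n

term-δ : ∀ a b c a′ b′ c′ → term a b c a′ b′ c′ ≡ δ a a′ ℕ.* (δ b b′ ℕ.* δ c c′)
term-δ a b c a′ b′ c′ with a ≡ᵇ a′ | b ≡ᵇ b′ | c ≡ᵇ c′
... | false | _     | _     = refl
... | true  | false | _     = refl
... | true  | true  | false = refl
... | true  | true  | true  = refl

-- The triple convolution of two monomials factors into three convolutions in one variable each.
term-* : ∀ d e → (termᵈ d *ˢ termᵈ e) ≈ˢ termᵈ (d +ᵈ e)
term-* (a , b , c) (a′ , b′ , c′) n m l = begin
  (term a b c *ˢ term a′ b′ c′) n m l
    ≡⟨ Σ≤³-cong n m l pointwise ⟩
  Σ≤³ n m l (λ i j k → f i ℕ.* (g j ℕ.* h k))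
    ≡⟨ Σ≤³-* n m l f g h ⟩
  Σ≤ n f ℕ.* (Σ≤ m g ℕ.* Σ≤ l h)
    ≡⟨ cong₂ ℕ._*_ (δ-convolution a a′ n) (cong₂ ℕ._*_ (δ-convolution b b′ m) (δ-convolution c c′ l)) ⟩
  δ (a ℕ.+ a′) n ℕ.* (δ (b ℕ.+ b′) m ℕ.* δ (c ℕ.+ c′) l)
    ≡⟨ term-δ (a ℕ.+ a′) (b ℕ.+ b′) (c ℕ.+ c′) n m l ⟨
  term (a ℕ.+ a′) (b ℕ.+ b′) (c ℕ.+ c′) n m l ∎
  where
  open ≡.≡-Reasoning
  f g h : ℕ → ℕ
  f i = δ a i ℕ.* δ a′ (n ∸ i)
  g j = δ b j ℕ.* δ b′ (m ∸ j)
  h k = δ c k ℕ.* δ c′ (l ∸ k)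
  pointwise : ∀ i j k → term a b c i j k ℕ.* term a′ b′ c′ (n ∸ i) (m ∸ j) (l ∸ k) ≡ f i ℕ.* (g j ℕ.* h k)
  pointwise i j k = ≡.trans
    (cong₂ ℕ._*_ (term-δ a b c i j k) (term-δ a′ b′ c′ (n ∸ i) (m ∸ j) (l ∸ k)))
    (≡.trans (*-interchange (δ a i) _ (δ a′ (n ∸ i)) _)
      (cong (f i ℕ.*_) (*-interchange (δ b j) _ (δ b′ (m ∸ j)) _)))

term-^ : ∀ d m → (termᵈ d ^ˢ m) ≈ˢ termᵈ (m ×ᵈ d)
term-^ d zero    a b c = refl
term-^ d (suc m) = ≈ˢ-trans {termᵈ d ^ˢ suc m} (*ˢ-cong {termᵈ d} (λ _ _ _ → refl) (term-^ d m)) (term-* d (m ×ᵈ d))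

termᵈ-refl : ∀ {d a b c} → d ≡ (a , b , c) → termᵈ d a b c ≡ 1
termᵈ-refl {a = a} {b} {c} refl rewrite term-δ a b c a b c | δ-refl a | δ-refl b | δ-refl c = refl

termᵈ-≢ : ∀ {d a b c} → d ≢ (a , b , c) → termᵈ d a b c ≡ 0
termᵈ-≢ {a , b , c} {a′} {b′} {c′} d≢ rewrite term-δ a b c a′ b′ c′
  with a ℕ.≟ a′ | b ℕ.≟ b′ | c ℕ.≟ c′
... | no a≢ | _ | _ rewrite δ-≢ a≢ = refl
... | yes _ | no b≢ | _ rewrite δ-≢ b≢ = ℕ.*-zeroʳ (δ a a′)
... | yes _ | yes _ | no c≢ rewrite δ-≢ c≢ | ℕ.*-zeroʳ (δ b b′) = ℕ.*-zeroʳ (δ a a′)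
... | yes refl | yes refl | yes refl = contradiction refl d≢

-- Degree generating functions of finite lists

module _ {A : Set} where

  genSeries : (A → Degree) → List A → Series
  genSeries deg []      = 0ˢ
  genSeries deg (z ∷ L) = termᵈ (deg z) +ˢ genSeries deg L

  -- The right-hand side has the form of the dimension in `homogeneous-dimension`; it thus remains
  -- to write `pathSeries` as a `genSeries`.
  genSeries-coefficient : ∀ deg L a b c →
    genSeries deg L a b c ≡ length (filter (λ z → deg z ≟ᵈ (a , b , c)) L)
  genSeries-coefficient deg []      a b c = refl
  genSeries-coefficient deg (z ∷ L) a b c with deg z ≟ᵈ (a , b , c)
  ... | yes e = cong₂ ℕ._+_ (termᵈ-refl e) (genSeries-coefficient deg L a b c)
  ... | no ≢  = cong₂ ℕ._+_ (termᵈ-≢ ≢) (genSeries-coefficient deg L a b c)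

  genSeries-++ : ∀ deg L L′ → (genSeries deg L +ˢ genSeries deg L′) ≈ˢ genSeries deg (L ++ L′)
  genSeries-++ deg []      L′ a b c = refl
  genSeries-++ deg (z ∷ L) L′ a b c =
    ≡.trans (ℕ.+-assoc (termᵈ (deg z) a b c) _ _) (cong (termᵈ (deg z) a b c ℕ.+_) (genSeries-++ deg L L′ a b c))

genSeries-map : ∀ {A B : Set} {f : A → B} {deg deg′} d → (∀ z → deg′ (f z) ≡ d +ᵈ deg z) →
  ∀ L → (termᵈ d *ˢ genSeries deg L) ≈ˢ genSeries deg′ (map f L)
genSeries-map d e [] = *ˢ-zeroʳ (termᵈ d)
genSeries-map {deg = deg} {deg′} d e (z ∷ L) = ≈ˢ-trans (*ˢ-distribˡ (termᵈ d) (termᵈ (deg z)) (genSeries deg L))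
  (+ˢ-cong (λ a b c → ≡.trans (term-* d (deg z) a b c) (cong (λ d → termᵈ d a b c) (≡.sym (e z))))
           (genSeries-map d e L))

-- By distributivity each element of the first list contributes a copy of the second series, shifted
-- by its degree.
genSeries-cartesianProductWith : ∀ {A B C : Set} {f : A → B → C} {degA degB degC} →
  (∀ y z → degC (f y z) ≡ degA y +ᵈ degB z) →
  ∀ L L′ → (genSeries degA L *ˢ genSeries degB L′) ≈ˢ genSeries degC (cartesianProductWith f L L′)
genSeries-cartesianProductWith {degB = degB} e [] L′ = *ˢ-zeroˡ (genSeries degB L′)
genSeries-cartesianProductWith {f = f} {degA} {degB} {degC} e (y ∷ L) L′ = ≈ˢ-trans
  (*ˢ-distribʳ (termᵈ (degA y)) (genSeries degA L) (genSeries degB L′))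
  (≈ˢ-trans (+ˢ-cong (genSeries-map (degA y) (e y) L′) (genSeries-cartesianProductWith {f = f} e L L′))
    (genSeries-++ degC (map (f y) L′) (cartesianProductWith f L L′)))

-- Boxes of exponents

upToℤ : ℤ → List ℕ
upToℤ (+ m)    = upTo m
-- The empty list matches the value zero of `[_]q` at negative integers.
upToℤ -[1+ _ ] = []

upToℤ-unique : ∀ z → Unique (upToℤ z)
upToℤ-unique (+ m)    = Unique.upTo⁺ m
upToℤ-unique -[1+ _ ] = []

∈-upToℤ⁺ : ∀ {k} z → + k ℤ.≤ z → k ∈ upToℤ (z ℤ.+ 1ℤ)
∈-upToℤ⁺ (+ m) (ℤ.+≤+ k≤m) rewrite ℕ.+-comm m 1 = ∈-upTo⁺ (ℕ.s≤s k≤m)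

∈-upToℤ⁻ : ∀ {k} z → k ∈ upToℤ (z ℤ.+ 1ℤ) → + k ℤ.≤ z
∈-upToℤ⁻ (+ m) k∈ rewrite ℕ.+-comm m 1 = ℤ.+≤+ (ℕ.s≤s⁻¹ (∈-upTo⁻ k∈))
-- At `z = -1` the shifted bound is `0`, and `upTo 0` is empty too.
∈-upToℤ⁻ -[1+ zero ] ()
∈-upToℤ⁻ -[1+ suc m ] ()

q-degree : ℕ → Degree
q-degree k = k , 0 , 0

[]q-genSeries : ∀ z → [ z ]q ≈ˢ genSeries q-degree (upToℤ z)
[]q-genSeries -[1+ _ ] a b c = refl
[]q-genSeries (+ m) = powers m id
  where
  -- Both sides peel off the index `0` and shift the others by `suc`; a general exponent function
  -- `f` absorbs these shifts.
  powers : ∀ m (f : ℕ → ℕ) → ∑ {m} (λ k → q ^ˢ f (toℕ k)) ≈ˢ genSeries q-degree (applyUpTo f m)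
  powers zero    f a b c = refl
  powers (suc m) f = +ˢ-cong
    (λ a b c → ≡.trans (term-^ (1 , 0 , 0) (f 0) a b c) (cong (λ d → termᵈ d a b c)
      (cong₂ _,_ (ℕ.*-identityʳ (f 0)) (cong₂ _,_ (ℕ.*-zeroʳ (f 0)) (ℕ.*-zeroʳ (f 0))))))
    (powers m (f ∘ suc))

-- The entries of `zs` are inclusive upper bounds while `upToℤ` excludes its bound, hence the shift
-- by one.
box : ∀ {n} → Vec ℤ n → List (Vec ℕ n)
box []       = [] ∷ []
box (z ∷ zs) = cartesianProductWith _∷_ (upToℤ (z ℤ.+ 1ℤ)) (box zs)

box-unique : ∀ {n} (zs : Vec ℤ n) → Unique (box zs)
box-unique []       = All.[] ∷ []
box-unique (z ∷ zs) =
  Unique.cartesianProductWith⁺ _∷_ Vec.∷-injective (upToℤ-unique (z ℤ.+ 1ℤ)) (box-unique zs)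

∈-box⁺ : ∀ {n} {b : Vec ℕ n} {zs} → Pointwise (λ bᵢ zᵢ → + bᵢ ℤ.≤ zᵢ) b zs → b ∈ box zs
∈-box⁺ []                 = here refl
∈-box⁺ (_∷_ {y = z} h hs) = ∈-cartesianProductWith⁺ _∷_ (∈-upToℤ⁺ z h) (∈-box⁺ hs)

∈-box⁻ : ∀ {n} {b : Vec ℕ n} zs → b ∈ box zs → Pointwise (λ bᵢ zᵢ → + bᵢ ℤ.≤ zᵢ) b zs
∈-box⁻ [] (here refl) = []
∈-box⁻ (z ∷ zs) b∈ with ∈-cartesianProductWith⁻ _∷_ (upToℤ (z ℤ.+ 1ℤ)) (box zs) b∈
... | _ , _ , h , hs , refl = ∈-upToℤ⁻ z h ∷ ∈-box⁻ zs hs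

-- Each q-integer enumerates one exponent, and their product enumerates the cartesian product
-- because the total exponent is additive.
box-genSeries : ∀ {n} (zs : Vec ℤ n) →
  ∏ (λ i → [ Vec.lookup zs i ℤ.+ 1ℤ ]q) ≈ˢ genSeries (q-degree ∘ Vec.sum) (box zs)
box-genSeries []       a b c = ≡.sym (ℕ.+-identityʳ _)
box-genSeries (z ∷ zs) = ≈ˢ-trans
  (*ˢ-cong ([]q-genSeries (z ℤ.+ 1ℤ)) (box-genSeries zs))
  (genSeries-cartesianProductWith {f = _∷_} (λ _ _ → refl) (upToℤ (z ℤ.+ 1ℤ)) (box zs))

-- Monomials attached to paths

TS-injective : ∀ {n} {π π′ : Vec Step n} → T π ≡ T π′ → S π ≡ S π′ → π ≡ π′
TS-injective {π = []}    {[]}      _ _ = refl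
TS-injective {π = s ∷ π} {s′ ∷ π′} e e′ with Vec.∷-injective e | Vec.∷-injective e′
... | h , t | h′ , t′ = cong₂ _∷_ (step s s′ h h′) (TS-injective t t′)
  where
  -- The four kinds of steps carry the four different pairs of decorations, so a path can be
  -- recovered from its two sets.
  step : ∀ s s′ → hasθ s ≡ hasθ s′ → hasξ s ≡ hasξ s′ → s ≡ s′
  step up          up          _ _ = refl
  step horizontalθ horizontalθ _ _ = refl
  step horizontalξ horizontalξ _ _ = refl
  step down        down        _ _ = refl

steps-unique : Unique (up ∷ horizontalθ ∷ horizontalξ ∷ down ∷ [])
steps-unique = ((λ ()) All.∷ (λ ()) All.∷ (λ ()) All.∷ All.[]) ∷ ((λ ()) All.∷ (λ ()) All.∷ All.[])
  ∷ ((λ ()) All.∷ All.[]) ∷ All.[] ∷ []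

allPaths-unique : ∀ n → Unique (allPaths n)
allPaths-unique zero    = All.[] ∷ []
allPaths-unique (suc n) = Unique.cartesianProductWith⁺ _∷_ Vec.∷-injective steps-unique (allPaths-unique n)

∈-allPaths : ∀ {n} (π : Vec Step n) → π ∈ allPaths n
∈-allPaths []      = here refl
∈-allPaths (s ∷ π) = ∈-cartesianProductWith⁺ _∷_ (∈-steps s) (∈-allPaths π)
  where
  ∈-steps : ∀ s → s ∈ (up ∷ horizontalθ ∷ horizontalξ ∷ down ∷ [])
  ∈-steps up          = here refl
  ∈-steps horizontalθ = there (here refl)
  ∈-steps horizontalξ = there (there (here refl))
  ∈-steps down        = there (there (there (here refl)))

pathMonomials : ∀ {n} → Vec Step n → List (Monomial n)
pathMonomials π = map (λ b → b , T π , S π) (box (β (T π) (S π)))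

pathSummand : ∀ {n} → Vec Step n → Series
pathSummand π = ((u ^ˢ degθ π) *ˢ (v ^ˢ degξ π)) *ˢ stair π

-- The powers of `u` and `v` multiply to a single term, which shifts the `q`-degrees of the box by
-- the degrees of the decorations.
pathSummand-genSeries : ∀ {n} (π : Vec Step n) → pathSummand π ≈ˢ genSeries degree (pathMonomials π)
pathSummand-genSeries π = ≈ˢ-trans
  (*ˢ-cong (≈ˢ-trans (*ˢ-cong (term-^ θ-degree (degθ π)) (term-^ ξ-degree (degξ π)))
                     (term-* (degθ π ×ᵈ θ-degree) (degξ π ×ᵈ ξ-degree)))
           (box-genSeries (β (T π) (S π))))
  (genSeries-map {deg = q-degree ∘ Vec.sum} (degθ π ×ᵈ θ-degree +ᵈ degξ π ×ᵈ ξ-degree)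
    (λ b → degree-split (Vec.sum b) (degθ π) (degξ π)) (box (β (T π) (S π))))
  where
  θ-degree ξ-degree : Degree
  θ-degree = 0 , 1 , 0
  ξ-degree = 0 , 0 , 1
  degree-split : ∀ a b c → (a , b , c) ≡ b ×ᵈ θ-degree +ᵈ c ×ᵈ ξ-degree +ᵈ q-degree a
  degree-split a b c rewrite ℕ.*-zeroʳ b | ℕ.*-zeroʳ c | ℕ.*-identityʳ b | ℕ.*-identityʳ c
    | ℕ.+-identityʳ b | ℕ.+-identityʳ b | ℕ.+-identityʳ c = refl

basisMonomials : ∀ n → List (Monomial n)
basisMonomials n = concatMap pathMonomials (Π≥0 n)

pathSeries-genSeries : ∀ n → pathSeries n ≈ˢ genSeries degree (basisMonomials n)
pathSeries-genSeries n = go (Π≥0 n)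
  where
  go : ∀ Π → List.foldr _+ˢ_ 0ˢ (map pathSummand Π) ≈ˢ genSeries degree (concatMap pathMonomials Π)
  go []      a b c = refl
  go (π ∷ Π) = ≈ˢ-trans (+ˢ-cong (pathSummand-genSeries π) (go Π))
    (genSeries-++ degree (pathMonomials π) (concatMap pathMonomials Π))

-- Monomials of one path differ in their exponents; those of distinct paths differ in at least one
-- of the two sets, by `TS-injective`.
basisMonomials-unique : ∀ n → Unique (basisMonomials n)
basisMonomials-unique n = Unique.concat⁺
  (All.map⁺ (All.universal (λ π → Unique.map⁺ (cong proj₁) (box-unique (β (T π) (S π)))) (Π≥0 n)))
  (AllPairs.map⁺ (AllPairs.map disjoint (Unique.filter⁺ InΠ≥0? (allPaths-unique n))))
  where
  disjoint : ∀ {π π′ : Vec Step n} → π ≢ π′ → ∀ {m} → ¬ (m ∈ pathMonomials π × m ∈ pathMonomials π′)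
  disjoint π≢ (m∈ , m∈′) with ∈-map⁻ _ m∈ | ∈-map⁻ _ m∈′
  ... | _ , _ , refl | _ , _ , e = π≢ (TS-injective (cong (proj₁ ∘ proj₂) e) (cong (proj₂ ∘ proj₂) e))

B⇒∈ : ∀ {n} {m : Monomial n} → B n m → m ∈ basisMonomials n
B⇒∈ {n} (π , π≥0 , refl , refl , b≤β) = ∈-concatMap⁺ pathMonomials {xs = Π≥0 n}
  (lose (∈-filter⁺ InΠ≥0? (∈-allPaths π) π≥0) (∈-map⁺ (λ b → b , T π , S π) (∈-box⁺ b≤β)))

∈⇒B : ∀ {n} {m : Monomial n} → m ∈ basisMonomials n → B n m
∈⇒B {n} m∈ with find (∈-concatMap⁻ pathMonomials {xs = Π≥0 n} m∈)
... | π , π∈ , m∈π with ∈-map⁻ _ m∈π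
...   | _ , b∈ , refl =
  π , proj₂ (∈-filter⁻ InΠ≥0? {xs = allPaths n} π∈) , refl , refl , ∈-box⁻ (β (T π) (S π)) b∈

-- The complex numbers

-- Here `inv k` is an inverse of the image of `suc k` in `K`, so multiplying `suc k ×ᴷ z` by it
-- recovers `z`.
invertible⇒torsionFree : ∀ {c ℓ} (K : CommutativeRing c ℓ) →
  let open CommutativeRing K; open SemiringMult semiring renaming (_×_ to _×ᴷ_) in
  (inv : ℕ → Carrier) → (∀ k → inv k * (suc k ×ᴷ 1#) ≈ 1#) → TorsionFree K
invertible⇒torsionFree K inv inv-left k z e = begin
  z                                   ≈⟨ *-identityˡ z ⟨
  1# * z                              ≈⟨ *-congʳ (inv-left k) ⟨
  (inv k * (suc k ×ᴷ 1#)) * z         ≈⟨ *-assoc (inv k) _ z ⟩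
  inv k * ((suc k ×ᴷ 1#) * z)         ≈⟨ *-congˡ (×-assoc-* (suc k) 1# z) ⟩
  inv k * (suc k ×ᴷ (1# * z))         ≈⟨ *-congˡ (×-congʳ (suc k) (*-identityˡ z)) ⟩
  inv k * (suc k ×ᴷ z)                ≈⟨ *-congˡ e ⟩
  inv k * 0#                          ≈⟨ zeroʳ (inv k) ⟩
  0#                                  ∎
  where
  open CommutativeRing K
  open SemiringMult semiring using (×-assoc-*; ×-congʳ) renaming (_×_ to _×ᴷ_)
  open SetoidReasoning setoid

open RawMonoidDefs ℚ.+-0-rawMonoid using () renaming (_×_ to _×ℚ_)

suc×1-positive : ∀ k → 0ℚ ℚ.< suc k ×ℚ 1ℚ
suc×1-positive zero    = ℚ.positive⁻¹ 1ℚ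
suc×1-positive (suc k) = ℚ.+-mono-< (ℚ.positive⁻¹ 1ℚ) (suc×1-positive k)

ι : ℚ → CommutativeRing.Carrier ℂ
ι p = Reals.fromℚ p , Reals.fromℚ 0ℚ

module _ where
  open CommutativeRing ℂ using (_*_; 1#; semiring)
  open SemiringMult semiring using () renaming (_×_ to _×ᶜ_)
  open Reals using (ℝ; _≈ʳ_)

  ≗⇒≈ʳ : {y z : ℝ} → (∀ k → proj₁ y k ≡ proj₁ z k) → y ≈ʳ z
  ≗⇒≈ʳ {y} {z} e ε 0<ε = 0 , λ k _ → ≡.subst (λ p → ℚ.∣ p ∣ ℚ.< ε)
    (≡.sym (≡.trans (cong (ℚ._- proj₁ z k) (e k)) (ℚ.+-inverseʳ (proj₁ z k)))) 0<ε

  -- Stated entry by entry with `≡`, so that the inverse can be checked by rational arithmetic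
  -- without estimates.
  ×1-sequence : ∀ k i → proj₁ (proj₁ (k ×ᶜ 1#)) i ≡ k ×ℚ 1ℚ
  ×1-sequence zero    i = refl
  ×1-sequence (suc k) i = cong (1ℚ ℚ.+_) (×1-sequence k i)

  ×1-imaginary : ∀ k i → proj₁ (proj₂ (k ×ᶜ 1#)) i ≡ 0ℚ
  ×1-imaginary zero    i = refl
  ×1-imaginary (suc k) i = ≡.trans (ℚ.+-identityˡ _) (×1-imaginary k i)

  ℂ-torsionFree : TorsionFree ℂ
  ℂ-torsionFree = invertible⇒torsionFree ℂ (λ k → ι (inv k)) λ k →
      ≗⇒≈ʳ {proj₁ (ι (inv k) * (suc k ×ᶜ 1#))} {proj₁ 1#} (λ i → ≡.trans
        (≡.cong₂ (λ p r → inv k ℚ.* p ℚ.- 0ℚ ℚ.* r) (×1-sequence (suc k) i) (×1-imaginary (suc k) i))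
        -- The subtracted product is now `0ℚ * 0ℚ`, which evaluates to zero, leaving `inv k` times
        -- `suc k ×ℚ 1ℚ`.
        (≡.trans (ℚ.+-identityʳ _) (ℚ.*-inverseˡ (suc k ×ℚ 1ℚ) {{nonZero k}})))
    , ≗⇒≈ʳ {proj₂ (ι (inv k) * (suc k ×ᶜ 1#))} {proj₂ 1#} (λ i → ≡.trans
        (≡.cong₂ (λ p r → inv k ℚ.* r ℚ.+ 0ℚ ℚ.* p) (×1-sequence (suc k) i) (×1-imaginary (suc k) i))
        (≡.cong₂ ℚ._+_ (ℚ.*-zeroʳ (inv k)) (ℚ.*-zeroˡ (suc k ×ℚ 1ℚ))))
    where
    nonZero : ∀ k → ℚ.NonZero (suc k ×ℚ 1ℚ)
    nonZero k = ℚ.pos⇒nonZero (suc k ×ℚ 1ℚ) {{ℚ.positive (suc×1-positive k)}}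
    inv : ℕ → ℚ
    inv k = ℚ.1/_ (suc k ×ℚ 1ℚ) {{nonZero k}}

-- The Hilbert series of the coinvariant ring

proposition9p7 : (n : ℕ) .{{_ : NonZero n}} →
    IsBasis (Coinvariants.R ℂ n) (B n) (Coinvariants.monomial ℂ n) →
    Coinvariants.IsHilbertSeries ℂ n (pathSeries n)
-- The dimension is found as a number of basis monomials and is transported along its equality with
-- the coefficient of `pathSeries n`.
proposition9p7 n basis a b c = ≡.subst (HasDimension R[ a , b , c ])
  (≡.trans (≡.sym (genSeries-coefficient degree (basisMonomials n) a b c)) (≡.sym (pathSeries-genSeries n a b c)))
  (homogeneous-dimension ℂ-torsionFree basis (basisMonomials-unique n) ∈⇒B B⇒∈ a b c)
  where
  open Coinvariants ℂ n using (R[_,_,_])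
  open Scaling ℂ n using (homogeneous-dimension)
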